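{- Let $\mathcal{G}$ be a minor-closed class of graphs of bounded treewidth, and let $t\ge 1$ be an integer. Then $\mathrm{col}_\star(\mathcal{G})\le t$ if and only if there exists an integer $m\ge 1$ such that $K_{t,m}\notin\mathcal{G}$ and $I_{t-1}+P_m\notin\mathcal{G}$.
   Context: All graphs are finite and simple. A class $\mathcal{G}$ of graphs is a (proper) minor-closed class if $\mathcal{G}$ does not contain all graphs and every minor of a graph in $\mathcal{G}$ also belongs to $\mathcal{G}$. A class has bounded treewidth if there is an integer $w$ with $\mathrm{tw}(G)\le w$ for all $G$ in the class. For an integer $t$, a $t$-island in a graph $G$ is a non-empty set $S\subseteq V(G)$ such that every vertex of $S$ has fewer than $t$ neighbors in $V(G)\setminus S$. For an integer $C\ge1$, $\mathrm{col}_C(G)$ is the smallest integer $t$ such that every non-empty subgraph of $G$ contains a $t$-island of size at most $C$. For a class $\mathcal{G}$, $\mathrm{col}_\star(\mathcal{G})$ is the smallest integer $t$ such that there exists $C\ge 1$ with $\mathrm{col}_C(G)\le t$ for every $G\in\mathcal{G}$ ($\infty$ if no such $t$ exists). $I_n+P_m$ denotes the graph consisting of a path on $m$ vertices together with $n$ additional vertices, each adjacent to all vertices of the path (and not to each other). $K_{t,m}$ is the complete bipartite graph. -}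

module Defs where

open import Data.Nat using (ℕ; zero; suc; _+_; _*_; _∸_; _≤_; _<_; _≡ᵇ_; _<ᵇ_)
open import Data.Bool using (Bool; true; false; _∧_; _∨_; not; if_then_else_)
open import Data.Bool.Properties using (∨-comm)
open import Data.Fin using (Fin; toℕ)
open import Data.Product using (Σ; ∃; ∃-syntax; _×_; _,_)
open import Data.Empty using (⊥)
open import Relation.Nullary using (¬_)
open import Relation.Binary.PropositionalEquality using (_≡_; refl; cong₂; _≢_)

record Graph : Set where
  field
    n      : ℕ
    adj    : Fin n → Fin n → Bool
    sym    : ∀ i j → adj i j ≡ adj j i
    irrefl : ∀ i → adj i i ≡ false
open Graph public

V : Graph → Set
V G = Fin (n G)

count : (k : ℕ) → (Fin k → Bool) → ℕ
count zero    P = 0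
count (suc k) P = (if P Fin.zero then 1 else 0) + count k (λ i → P (Fin.suc i))

sumFin : (k : ℕ) → (Fin k → ℕ) → ℕ
sumFin zero    f = 0
sumFin (suc k) f = f Fin.zero + sumFin k (λ i → f (Fin.suc i))

private
  ≡ᵇ-refl : ∀ a → (a ≡ᵇ a) ≡ true
  ≡ᵇ-refl zero    = refl
  ≡ᵇ-refl (suc a) = ≡ᵇ-refl a

  ≡ᵇ-sym : ∀ a b → (a ≡ᵇ b) ≡ (b ≡ᵇ a)
  ≡ᵇ-sym zero    zero    = refl
  ≡ᵇ-sym zero    (suc b) = refl
  ≡ᵇ-sym (suc a) zero    = refl
  ≡ᵇ-sym (suc a) (suc b) = ≡ᵇ-sym a b

  ∧-false : ∀ b → b ∧ false ≡ false
  ∧-false true  = refl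
  ∧-false false = refl

mkGraph : (k : ℕ) → (Fin k → Fin k → Bool) → Graph
mkGraph k r = record
  { n      = k
  ; adj    = λ i j → (r i j ∨ r j i) ∧ not (toℕ i ≡ᵇ toℕ j)
  ; sym    = λ i j → cong₂ (λ a b → a ∧ not b) (∨-comm (r i j) (r j i))
                             (≡ᵇ-sym (toℕ i) (toℕ j))
  ; irrefl = λ i → helper i
  }
  where
  helper : ∀ i → (r i i ∨ r i i) ∧ not (toℕ i ≡ᵇ toℕ i) ≡ false
  helper i rewrite ≡ᵇ-refl (toℕ i) = ∧-false (r i i ∨ r i i)

K : ℕ → ℕ → Graph
K t m = mkGraph (t + m) (λ i j → (toℕ i <ᵇ t) ∧ not (toℕ j <ᵇ t))

-- I_a + P_m: vertices 0..a-1 are the apices (pairwise non-adjacent),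
-- vertices a..a+m-1 form the path a, a+1, ..., a+m-1; every apex is
-- adjacent to every path vertex.
IP : ℕ → ℕ → Graph
IP a m = mkGraph (a + m) (λ i j →
  ((toℕ i <ᵇ a) ∧ not (toℕ j <ᵇ a))
  ∨ (not (toℕ i <ᵇ a) ∧ (toℕ j ≡ᵇ suc (toℕ i))))

data Reach (G : Graph) (S : V G → Bool) : V G → V G → Set where
  here : ∀ {u} → S u ≡ true → Reach G S u u
  step : ∀ {u w v} → S u ≡ true → adj G u w ≡ true → Reach G S w v → Reach G S u v

record Minor (H G : Graph) : Set where
  field
    branch    : V H → V G → Bool
    nonempty  : ∀ x → ∃[ v ] branch x v ≡ true
    disjoint  : ∀ x y v → x ≢ y → branch x v ≡ true → branch y v ≡ true → ⊥
    connected : ∀ x u v → branch x u ≡ true → branch x v ≡ true → Reach G (branch x) u v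
    edges     : ∀ x y → adj H x y ≡ true →
                ∃[ u ] ∃[ v ] (branch x u ≡ true × branch y v ≡ true × adj G u v ≡ true)

Class : Set₁
Class = Graph → Set

MinorClosed : Class → Set
MinorClosed 𝒢 = (∃[ G ] ¬ 𝒢 G) × (∀ G H → 𝒢 G → Minor H G → 𝒢 H)

-- a tree: non-empty, connected, and with exactly |V| - 1 edges
-- (the sum of degrees equals 2(|V| - 1)).
record IsTree (T : Graph) : Set where
  field
    nonempty  : 0 < n T
    connected : ∀ u v → Reach T (λ _ → true) u v
    edgeCount : sumFin (n T) (λ i → count (n T) (adj T i)) + 2 ≡ 2 * n T

record TreeDecomp (G : Graph) (w : ℕ) : Set where
  field
    tree      : Graph
    isTree    : IsTree tree
    bag       : V tree → V G → Bool
    coverV    : ∀ v → ∃[ x ] bag x v ≡ true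
    coverE    : ∀ u v → adj G u v ≡ true → ∃[ x ] (bag x u ≡ true × bag x v ≡ true)
    coherent  : ∀ v x y → bag x v ≡ true → bag y v ≡ true →
                Reach tree (λ z → bag z v) x y
    bagSize   : ∀ x → count (n G) (bag x) ≤ suc w

TwLe : Graph → ℕ → Set
TwLe G w = TreeDecomp G w

BoundedTreewidth : Class → Set
BoundedTreewidth 𝒢 = ∃[ w ] (∀ G → 𝒢 G → TwLe G w)

record Subgraph (G : Graph) : Set where
  field
    S    : V G → Bool
    F    : V G → V G → Bool
    Fsym : ∀ u v → F u v ≡ F v u
    Fsub : ∀ u v → F u v ≡ true → adj G u v ≡ true
    Fend : ∀ u v → F u v ≡ true → S u ≡ true
open Subgraph public

NonEmptySub : {G : Graph} → Subgraph G → Set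
NonEmptySub {G} H = ∃[ v ] S H v ≡ true

IsIsland : {G : Graph} → Subgraph G → ℕ → (V G → Bool) → Set
IsIsland {G} H t X =
  (∀ v → X v ≡ true → S H v ≡ true)
  × (∃[ v ] X v ≡ true)
  × (∀ v → X v ≡ true → count (n G) (λ w → F H v w ∧ not (X w)) < t)

IslandProp : ℕ → ℕ → Graph → Set
IslandProp C t G = ∀ (H : Subgraph G) → NonEmptySub H →
  ∃[ X ] (IsIsland H t X × count (n G) X ≤ C)

-- col_C(G) ≤ t   (col_C(G) is the least t with IslandProp C t G)
ColLe : ℕ → Graph → ℕ → Set
ColLe C G t = ∃[ t' ] (t' ≤ t × IslandProp C t' G)

-- col_⋆(𝒢) ≤ t   (col_⋆(𝒢) is the least t' for which some C ≥ 1 has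
-- col_C(G) ≤ t' for all G ∈ 𝒢; it is ∞ when no such t' exists)
ColStarLe : Class → ℕ → Set
ColStarLe 𝒢 t = ∃[ t' ] (t' ≤ t × ∃[ C ] (1 ≤ C × (∀ G → 𝒢 G → ColLe C G t')))

module Submission where

-- Excluding K_{t,m} and I_{t-1} + P_m is necessary since, for large m, an island of bounded size cannot
-- contain one of the high-degree vertices, and the remaining vertices offer no island either.
-- Conversely, suppose that a subgraph of G has no t-island of size at most C. Walking down a tree
-- decomposition as long as many vertices lie below, one meets only nodes with few children: every child
-- contributes a vertex with t neighbours in the bag, and many of these give K_{t,m}. Hence there is a long
-- nested sequence of separators of bounded order with at most C vertices below all of them. Menger's
-- theorem and an induction on the order of the separators turn it into a long sequence of separators that
-- are disjoint, apart from common vertices, and are crossed by as many disjoint connected sets as they have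
-- vertices. The region between separators far enough apart is not an island, so it contains a vertex
-- with t neighbours on a single separator, that is, on t different strands. By pigeonhole many of
-- these vertices see the same strands; if they lie on no strand this gives K_{t,m}, and if they lie on a
-- common strand, that strand becomes the path of I_{t-1} + P_m.

open import Defs hiding (sym; n; S; F)
open import Data.Nat using (ℕ; zero; suc; _+_; _*_; _∸_; _^_; _≤_; _<_; z≤n; s≤s; _<ᵇ_; _≡ᵇ_; _≤?_; _<?_)
import Data.Nat.Properties as ℕ
open import Data.Nat.Solver using (module +-*-Solver)
open +-*-Solver using (solve; _:=_; _:+_; con; _:*_)
open import Algebra.Properties.CommutativeSemigroup ℕ.+-commutativeSemigroup using (interchange)
open import Data.Bool using (Bool; true; false; _∧_; _∨_; not; if_then_else_) renaming (T to So)
import Data.Bool.Properties as 𝔹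
open import Data.Fin using (Fin; zero; suc; toℕ; fromℕ<; _↑ˡ_; _↑ʳ_; splitAt; join; inject≤; punchIn)
import Data.Fin.Properties as Fin
open import Data.Fin.Subset.Properties using (anySubset?)
open import Data.Vec using (lookup; tabulate)
open import Data.Vec.Properties using (lookup∘tabulate)
import Data.Vec.Functional as Vector
open import Data.List using (List; []; _∷_; filter; cartesianProduct; allFin)
open import Data.List.Membership.Propositional using () renaming (_∈_ to _∈ˡ_)
open import Data.List.Membership.Propositional.Properties using (∈-filter⁺; ∈-filter⁻; ∈-cartesianProduct⁺; ∈-allFin)
open import Data.List.Relation.Unary.Any using (here; there)
open import Data.Product using (Σ; ∃; ∃-syntax; _×_; _,_; proj₁; proj₂)
open import Data.Sum using (_⊎_; inj₁; inj₂; [_,_]′)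
open import Data.Empty using (⊥; ⊥-elim)
open import Relation.Binary using (tri<; tri≈; tri>)
open import Relation.Nullary using (¬_; Dec; yes; no; does; contradiction)
open import Relation.Nullary.Decidable using (_×-dec_; _→-dec_; ¬?; dec-true; map′)
open import Relation.Binary.PropositionalEquality using (_≡_; refl; sym; trans; cong; cong₂; subst; subst₂; _≢_)
open import Function using (_∘_; id; case_of_)
open import Function.Bundles using (_⇔_; mk⇔)

-- Finite sets

-- The hypothesis speaks only of sets of at most C vertices, yet the sequence of separators must be
-- as long as the pigeonhole arguments demand. The constants are therefore chosen in this order: the
-- number of regions from `m` and the bag size `b`, then the length of the sequence, and only then
-- C, which bounds every set to which the hypothesis is applied. Separators alone would not suffice:
-- vertices whose neighbours lie on different separators share no branch sets. The crossing
-- connected sets, called strands, repair this, since a neighbour on a separator can be replaced by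
-- the whole strand through it. A vertex common to all separators counts as a strand of its own.
-- There are at most `b` strands, so the strands that a vertex sees form one of at most `2 ^ b`
-- sets. Absence of small islands is decided by finite search and then used positively, as a supply
-- of vertices with many neighbours outside a given set. In most of the code `suc t` stands for the
-- t of the theorem, so the excluded graphs are `K (suc t) m` and `IP t m`.

FSet : ℕ → Set
FSet n = Fin n → Bool

module _ {n : ℕ} where

  infix 4 _∈_ _∉_ _∈?_ _⊆_
  infixr 7 _∩_
  infixr 6 _∪_ _∖_

  _∈_ _∉_ : Fin n → FSet n → Set
  v ∈ X = X v ≡ true
  v ∉ X = ¬ v ∈ X

  _⊆_ : FSet n → FSet n → Set
  X ⊆ Y = ∀ {v} → v ∈ X → v ∈ Y

  _∈?_ : ∀ v X → Dec (v ∈ X)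
  v ∈? X = X v 𝔹.≟ true

  _∪_ _∩_ _∖_ : FSet n → FSet n → FSet n
  (X ∪ Y) v = X v ∨ Y v
  (X ∩ Y) v = X v ∧ Y v
  (X ∖ Y) v = X v ∧ not (Y v)

  ∁ : FSet n → FSet n
  ∁ X v = not (X v)

  ⁅_⁆ : Fin n → FSet n
  ⁅ x ⁆ v = does (v Fin.≟ x)

  ∪⁺ˡ : ∀ X Y {v} → v ∈ X → v ∈ X ∪ Y
  ∪⁺ˡ X Y {v} p rewrite p = refl

  ∪⁺ʳ : ∀ X Y {v} → v ∈ Y → v ∈ X ∪ Y
  ∪⁺ʳ X Y {v} p rewrite p = 𝔹.∨-zeroʳ (X v)

  ∪⁻ : ∀ X Y {v} → v ∈ X ∪ Y → v ∈ X ⊎ v ∈ Y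
  ∪⁻ X Y {v} p with X v
  ... | true  = inj₁ refl
  ... | false = inj₂ p

  ∩⁺ : ∀ X Y {v} → v ∈ X → v ∈ Y → v ∈ X ∩ Y
  ∩⁺ X Y p q rewrite p | q = refl

  ∩⁻ : ∀ X Y {v} → v ∈ X ∩ Y → v ∈ X × v ∈ Y
  ∩⁻ X Y {v} p with X v | Y v | p
  ... | true | true | _ = refl , refl

  ∁⁺ : ∀ X {v} → v ∉ X → v ∈ ∁ X
  ∁⁺ X {v} p with X v
  ... | true  = contradiction refl p
  ... | false = refl

  ∁⁻ : ∀ X {v} → v ∈ ∁ X → v ∉ X
  ∁⁻ X {v} p q rewrite q = case p of λ ()

  ∖⁺ : ∀ X Y {v} → v ∈ X → v ∉ Y → v ∈ X ∖ Y
  ∖⁺ X Y p q = ∩⁺ X (∁ Y) p (∁⁺ Y q)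

  ∖⁻ : ∀ X Y {v} → v ∈ X ∖ Y → v ∈ X × v ∉ Y
  ∖⁻ X Y p = let a , b = ∩⁻ X (∁ Y) p in a , ∁⁻ Y b

  ⁅⁆⁺ : ∀ v → v ∈ ⁅ v ⁆
  ⁅⁆⁺ v = dec-true (v Fin.≟ v) refl

  ⁅⁆⁻ : ∀ {x v} → v ∈ ⁅ x ⁆ → v ≡ x
  ⁅⁆⁻ {x} {v} p with v Fin.≟ x
  ... | yes q = q
  ... | no _  = case p of λ ()

∣_∣ : ∀ {n} → FSet n → ℕ
∣_∣ {n} X = count n X

nth : ∀ {n} (X : FSet n) → Fin ∣ X ∣ → Fin n
nth {suc n} X i with X zero
nth {suc n} X zero    | true  = zero
nth {suc n} X (suc i) | true  = suc (nth (X ∘ suc) i)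
nth {suc n} X i       | false = suc (nth (X ∘ suc) i)

nth-∈ : ∀ {n} (X : FSet n) i → nth X i ∈ X
nth-∈ {suc n} X i with X zero in eq
nth-∈ {suc n} X zero    | true  = eq
nth-∈ {suc n} X (suc i) | true  = nth-∈ (X ∘ suc) i
nth-∈ {suc n} X i       | false = nth-∈ (X ∘ suc) i

nth-injective : ∀ {n} (X : FSet n) {i j} → nth X i ≡ nth X j → i ≡ j
nth-injective {suc n} X {i} {j} p with X zero
nth-injective {suc n} X {zero}  {zero}  p | true = refl
nth-injective {suc n} X {suc i} {suc j} p | true = cong suc (nth-injective (X ∘ suc) (Fin.suc-injective p))
nth-injective {suc n} X {i}     {j}     p | false = nth-injective (X ∘ suc) (Fin.suc-injective p)

nth-surjective : ∀ {n} (X : FSet n) {v} → v ∈ X → ∃[ i ] nth X i ≡ v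
nth-surjective {suc n} X {v} p with X zero in eq
nth-surjective {suc n} X {zero}  p | true  = zero , refl
nth-surjective {suc n} X {suc v} p | true  = let i , e = nth-surjective (X ∘ suc) {v} p in suc i , cong suc e
nth-surjective {suc n} X {zero}  p | false = case trans (sym eq) p of λ ()
nth-surjective {suc n} X {suc v} p | false = let i , e = nth-surjective (X ∘ suc) {v} p in i , cong suc e

Inj : ∀ {A B : Set} → (A → B) → Set
Inj f = ∀ {x y} → f x ≡ f y → x ≡ y

inject≤-inj : ∀ {m n} (p : m ≤ n) → Inj (λ i → inject≤ i p)
inject≤-inj p {i} {j} = Fin.inject≤-injective p p i j

choose : ∀ {n k} (X : FSet n) → k ≤ ∣ X ∣ → Σ (Fin k → Fin n) λ f → Inj f × (∀ i → f i ∈ X)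
choose X le = (λ i → nth X (inject≤ i le)) , (λ e → inject≤-inj le (nth-injective X e)) , λ i → nth-∈ X _

injection⇒≤∣∣ : ∀ {n k} (X : FSet n) (f : Fin k → Fin n) → Inj f → (∀ i → f i ∈ X) → k ≤ ∣ X ∣
injection⇒≤∣∣ X f inj f∈X = Fin.injective⇒≤ {f = λ i → proj₁ (nth-surjective X (f∈X i))}
  λ {i} {j} e → inj (trans (sym (proj₂ (nth-surjective X (f∈X i)))) (trans (cong (nth X) e) (proj₂ (nth-surjective X (f∈X j)))))

∣∣-mono : ∀ {n} (X Y : FSet n) → X ⊆ Y → ∣ X ∣ ≤ ∣ Y ∣
∣∣-mono X Y X⊆Y = injection⇒≤∣∣ Y (nth X) (nth-injective X) (λ i → X⊆Y (nth-∈ X i))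

∣∪∣≤ : ∀ {n} (X Y : FSet n) → ∣ X ∪ Y ∣ ≤ ∣ X ∣ + ∣ Y ∣
∣∪∣≤ {zero}  X Y = z≤n
∣∪∣≤ {suc n} X Y with X zero | Y zero
... | true  | true  = s≤s (ℕ.≤-trans (∣∪∣≤ (X ∘ suc) (Y ∘ suc)) (ℕ.+-monoʳ-≤ _ (ℕ.n≤1+n _)))
... | true  | false = s≤s (∣∪∣≤ (X ∘ suc) (Y ∘ suc))
... | false | true  = ℕ.≤-trans (s≤s (∣∪∣≤ (X ∘ suc) (Y ∘ suc))) (ℕ.≤-reflexive (sym (ℕ.+-suc _ _)))
... | false | false = ∣∪∣≤ (X ∘ suc) (Y ∘ suc)

∣∣-cover : ∀ {n} (X Y Z : FSet n) → (∀ {v} → v ∈ X → v ∈ Y ⊎ v ∈ Z) → ∣ X ∣ ≤ ∣ Y ∣ + ∣ Z ∣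
∣∣-cover X Y Z c = ℕ.≤-trans (∣∣-mono X (Y ∪ Z) (λ p → [ ∪⁺ˡ Y Z , ∪⁺ʳ Y Z ]′ (c p))) (∣∪∣≤ Y Z)

∣∅∣ : ∀ {n} (X : FSet n) → (∀ v → v ∉ X) → ∣ X ∣ ≡ 0
∣∅∣ {zero}  X e = refl
∣∅∣ {suc n} X e with X zero in eq
... | true  = contradiction eq (e zero)
... | false = ∣∅∣ (X ∘ suc) (e ∘ suc)

∣⁅⁆∣≤1 : ∀ {n} (x : Fin n) → ∣ ⁅ x ⁆ ∣ ≤ 1
∣⁅⁆∣≤1 x with ∣ ⁅ x ⁆ ∣ in eq
... | zero = z≤n
... | suc zero = s≤s z≤n
... | suc (suc k) with choose {k = 2} ⁅ x ⁆ (subst (2 ≤_) (sym eq) (s≤s (s≤s z≤n)))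
...   | f , inj , f∈ with inj {zero} {suc zero} (trans (⁅⁆⁻ (f∈ zero)) (sym (⁅⁆⁻ (f∈ (suc zero)))))
...     | ()

∣∣>⇒∃∖ : ∀ {n} (X Y : FSet n) → ∣ Y ∣ < ∣ X ∣ → ∃[ v ] (v ∈ X × v ∉ Y)
∣∣>⇒∃∖ X Y lt with Fin.any? (λ v → v ∈? X ∖ Y)
... | yes (v , p) = v , ∖⁻ X Y p
... | no none = contradiction (∣∣-mono X Y sub) (ℕ.<⇒≱ lt)
  where
  sub : X ⊆ Y
  sub {v} v∈X with v ∈? Y
  ... | yes p = p
  ... | no ¬p = contradiction (v , ∖⁺ X Y v∈X ¬p) none

-- A missed element, put in front of `f`, would give `k + 1` distinct elements of `X`.
injection-onto : ∀ {n k} (X : FSet n) (f : Fin k → Fin n) → Inj f → (∀ i → f i ∈ X) → ∣ X ∣ ≤ k →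
  ∀ {z} → z ∈ X → ∃[ i ] f i ≡ z
injection-onto {n} {k} X f inj f∈X le {z} z∈X with Fin.any? (λ i → f i Fin.≟ z)
... | yes p = p
... | no none = contradiction (ℕ.≤-trans (injection⇒≤∣∣ X g g-inj g∈X) le) ℕ.1+n≰n
  where
  g : Fin (suc k) → Fin n
  g zero    = z
  g (suc i) = f i
  g-inj : Inj g
  g-inj {zero}  {zero}  e = refl
  g-inj {zero}  {suc j} e = contradiction (j , sym e) none
  g-inj {suc i} {zero}  e = contradiction (i , e) none
  g-inj {suc i} {suc j} e = cong suc (inj e)
  g∈X : ∀ i → g i ∈ X
  g∈X zero    = z∈X
  g∈X (suc i) = f∈X i

∣∣-⋃ : ∀ {n N} (X : FSet n) (I : FSet N) (E : Fin N → FSet n) e →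
  (∀ {v} → v ∈ X → ∃[ c ] (c ∈ I × v ∈ E c)) → (∀ {c} → c ∈ I → ∣ E c ∣ ≤ e) → ∣ X ∣ ≤ ∣ I ∣ * e
∣∣-⋃ {n} {zero} X I E e cov bd = ℕ.≤-reflexive (∣∅∣ X λ v p → case cov p of λ { (() , _) })
∣∣-⋃ {n} {suc N} X I E e cov bd with I zero in eq
... | false = ∣∣-⋃ X (I ∘ suc) (E ∘ suc) e cov′ bd
  where
  cov′ : ∀ {v} → v ∈ X → ∃[ c ] (c ∈ I ∘ suc × v ∈ E (suc c))
  cov′ p with cov p
  ... | zero  , a , b = case trans (sym eq) a of λ ()
  ... | suc c , a , b = c , a , b
... | true = ℕ.≤-trans (∣∣-cover X (E zero) (X ∖ E zero) split) (ℕ.+-mono-≤ (bd eq) (∣∣-⋃ (X ∖ E zero) (I ∘ suc) (E ∘ suc) e cov′ bd))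
  where
  split : ∀ {v} → v ∈ X → v ∈ E zero ⊎ v ∈ X ∖ E zero
  split {v} p with v ∈? E zero
  ... | yes q = inj₁ q
  ... | no q  = inj₂ (∖⁺ X (E zero) p q)
  cov′ : ∀ {v} → v ∈ X ∖ E zero → ∃[ c ] (c ∈ I ∘ suc × v ∈ E (suc c))
  cov′ p with ∖⁻ X (E zero) p
  ... | q , ¬z with cov q
  ... | zero  , a , b = contradiction b ¬z
  ... | suc c , a , b = c , a , b

∈⇒0<∣∣ : ∀ {n} (X : FSet n) {v} → v ∈ X → 0 < ∣ X ∣
∈⇒0<∣∣ X {v} p = injection⇒≤∣∣ X (λ (_ : Fin 1) → v) (λ { {zero} {zero} _ → refl }) (λ _ → p)

-- Connectivity and Menger's theorem

Rel : ℕ → Set₁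
Rel n = Fin n → Fin n → Set

data Walk {n} (E : Rel n) (P : FSet n) : Fin n → Fin n → Set where
  stop : ∀ {u} → u ∈ P → Walk E P u u
  go   : ∀ {u w v} → u ∈ P → E u w → Walk E P w v → Walk E P u v

module _ {n} {E : Rel n} where

  walk-start : ∀ {P u v} → Walk E P u v → u ∈ P
  walk-start (stop p) = p
  walk-start (go p _ _) = p

  walk-end : ∀ {P u v} → Walk E P u v → v ∈ P
  walk-end (stop p) = p
  walk-end (go _ _ ω) = walk-end ω

  walk-++ : ∀ {P u v w} → Walk E P u v → Walk E P v w → Walk E P u w
  walk-++ (stop _) ω = ω
  walk-++ (go p e ω₁) ω = go p e (walk-++ ω₁ ω)

  walk-map : ∀ {E′ : Rel n} {P Q u v} → (∀ {x y} → E x y → E′ x y) → (∀ {x} → x ∈ P → x ∈ Q) → Walk E P u v → Walk E′ Q u v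
  walk-map f g (stop p) = stop (g p)
  walk-map f g (go p e ω) = go (g p) (f e) (walk-map f g ω)

  walk-reverse : (∀ {x y} → E x y → E y x) → ∀ {P u v} → Walk E P u v → Walk E P v u
  walk-reverse s (stop p) = stop p
  walk-reverse s (go p e ω) = walk-++ (walk-reverse s ω) (go (walk-start ω) (s e) (stop p))

  walk-closed : ∀ {P M u v} → (∀ {x y} → x ∈ P → x ∈ M → E x y → y ∈ P → y ∈ M) → u ∈ M → Walk E P u v → v ∈ M
  walk-closed c m (stop _) = m
  walk-closed c m (go p e ω) = walk-closed c (c p m e (walk-start ω)) ω

  -- Stop at the first visit to `x`: before that, no step leaves `M`.
  walk-clip : ∀ {P M u x} → (∀ {y z} → y ∈ P → y ∈ M → y ≢ x → E y z → z ∈ P → z ∈ M) →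
    u ∈ M → Walk E P u x → Walk E (P ∩ M) u x
  walk-clip {P} {M} c m (stop p) = stop (∩⁺ P M p m)
  walk-clip {P} {M} {u} {x} c m (go p e ω) with u Fin.≟ x
  ... | yes refl = stop (∩⁺ P M p m)
  ... | no u≢x   = go (∩⁺ P M p m) e (walk-clip c (c p m u≢x e (walk-start ω)) ω)

Connected : ∀ {n} → Rel n → FSet n → Set
Connected E P = ∀ {u v} → u ∈ P → v ∈ P → Walk E P u v

connected-clip : ∀ {n} {E : Rel n} (P M : FSet n) x → (∀ {y z} → E y z → E z y) → Connected E P → x ∈ P →
  (∀ {y z} → y ∈ P → y ∈ M → y ≢ x → E y z → z ∈ P → z ∈ M) → Connected E (P ∩ M)
connected-clip P M x s conn x∈P c p q =
  let p₁ , p₂ = ∩⁻ P M p ; q₁ , q₂ = ∩⁻ P M q in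
  walk-++ (walk-clip c p₂ (conn p₁ x∈P)) (walk-reverse s (walk-clip c q₂ (conn q₁ x∈P)))

-- By counting, `k` disjoint sets that each meet a set of at most `k` points use up all its points,
-- one each. This is what later allows connected sets to be cut at a separator without falling
-- apart.
transversal : ∀ {n k} (P : Fin k → FSet n) (X : FSet n) → (∀ {i j v} → v ∈ P i → v ∈ P j → i ≡ j) →
  (x : Fin k → Fin n) → (∀ i → x i ∈ P i) → (∀ i → x i ∈ X) → ∣ X ∣ ≤ k →
  (∀ {z} → z ∈ X → ∃[ i ] x i ≡ z) × (∀ {i z} → z ∈ X → z ∈ P i → z ≡ x i)
transversal P X disj x x∈P x∈X le = onto , uniq
  where
  onto : ∀ {z} → z ∈ X → ∃[ i ] x i ≡ z
  onto = injection-onto X x (λ {i} {j} e → disj (x∈P i) (subst (_∈ P j) (sym e) (x∈P j))) x∈X le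
  uniq : ∀ {i z} → z ∈ X → z ∈ P i → z ≡ x i
  uniq {i} z∈X z∈P with onto z∈X
  ... | j , refl = cong x (disj (x∈P j) z∈P)

module Menger {n : ℕ} where

  Adj : List (Fin n × Fin n) → Rel n
  Adj es u v = (u , v) ∈ˡ es ⊎ (v , u) ∈ˡ es

  Adj-sym : ∀ {es u v} → Adj es u v → Adj es v u
  Adj-sym = [ inj₂ , inj₁ ]′

  Adj-there : ∀ {e es u v} → Adj es u v → Adj (e ∷ es) u v
  Adj-there = [ inj₁ ∘ there , inj₂ ∘ there ]′

  -- R certifies that S separates A from B: it contains whatever A reaches while avoiding S.
  record Separator (es : List (Fin n × Fin n)) (A B : FSet n) : Set where
    field
      S R    : FSet n
      source : ∀ {v} → v ∈ A → v ∈ R ⊎ v ∈ S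
      target : ∀ {v} → v ∈ R → v ∉ B
      RS     : ∀ {v} → v ∈ R → v ∉ S
      closed : ∀ {u v} → u ∈ R → Adj es u v → v ∈ R ⊎ v ∈ S

  SmallSeparator : List (Fin n × Fin n) → FSet n → FSet n → ℕ → Set
  SmallSeparator es A B k = Σ (Separator es A B) λ s → ∣ Separator.S s ∣ < k

  -- Connected sets take the place of paths: branch sets of a minor need no more, and gluing them
  -- needs no order along a path.
  record Linkage (es : List (Fin n × Fin n)) (A B : FSet n) (k : ℕ) : Set where
    field
      P        : Fin k → FSet n
      disj     : ∀ {i j v} → v ∈ P i → v ∈ P j → i ≡ j
      conn     : ∀ i → Connected (Adj es) (P i)
      a b      : Fin k → Fin n
      a∈P      : ∀ i → a i ∈ P i
      b∈P      : ∀ i → b i ∈ P i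
      a∈A      : ∀ i → a i ∈ A
      b∈B      : ∀ i → b i ∈ B

  flip-separator : ∀ {es A B} → Separator es A B → Separator es B A
  flip-separator {es} {A} {B} s = record
    { S = S ; R = ∁ (R ∪ S)
    ; source = λ v∈B → out λ r → target r v∈B
    ; target = λ v∈R′ v∈A → ∁⁻ (R ∪ S) v∈R′ ([ ∪⁺ˡ R S , ∪⁺ʳ R S ]′ (source v∈A))
    ; RS = λ v∈R′ v∈S → ∁⁻ (R ∪ S) v∈R′ (∪⁺ʳ R S v∈S)
    ; closed = λ u∈R′ e → out λ r → ∁⁻ (R ∪ S) u∈R′ ([ ∪⁺ˡ R S , ∪⁺ʳ R S ]′ (closed r (Adj-sym e)))
    }
    where
    open Separator s
    out : ∀ {v} → v ∉ R → v ∈ ∁ (R ∪ S) ⊎ v ∈ S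
    out {v} ¬r with v ∈? S
    ... | yes q = inj₂ q
    ... | no ¬q = inj₁ (∁⁺ (R ∪ S) ([ ¬r , ¬q ]′ ∘ ∪⁻ R S))

  -- What is reached from `A` leaves `R` only through `S`, hence through `X`, and `S′` guards `X`. A
  -- new edge starts in `X` or outside `R`, so it never starts in `R′ ∩ R`.
  pull-separator : ∀ {es es′ A B X k} (s : Separator es A B) → let open Separator s in
    (∀ {u v} → Adj es′ u v → Adj es u v ⊎ u ∈ X ⊎ u ∉ R) → S ⊆ X →
    SmallSeparator es A X k → SmallSeparator es′ A B k
  pull-separator {es} {es′} {A} {B} {X} s edge S⊆X (s′ , lt) = record
    { S = S′ ∩ (R ∪ S) ; R = R′ ∩ R
    ; source = λ v∈A → meet (source′ v∈A) (source v∈A)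
    ; target = λ p → target (proj₂ (∩⁻ R′ R p))
    ; RS = λ p q → RS′ (proj₁ (∩⁻ R′ R p)) (proj₁ (∩⁻ S′ (R ∪ S) q))
    ; closed = closed″
    } , ℕ.≤-<-trans (∣∣-mono (S′ ∩ (R ∪ S)) S′ (proj₁ ∘ ∩⁻ S′ (R ∪ S))) lt
    where
    open Separator s
    open Separator s′ renaming (S to S′; R to R′; source to source′; target to target′; RS to RS′; closed to closed′)
    meet : ∀ {v} → v ∈ R′ ⊎ v ∈ S′ → v ∈ R ⊎ v ∈ S → v ∈ R′ ∩ R ⊎ v ∈ S′ ∩ (R ∪ S)
    meet (inj₁ r′) (inj₁ r) = inj₁ (∩⁺ R′ R r′ r)
    meet (inj₁ r′) (inj₂ q) = contradiction (S⊆X q) (target′ r′)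
    meet (inj₂ q′) p        = inj₂ (∩⁺ S′ (R ∪ S) q′ ([ ∪⁺ˡ R S , ∪⁺ʳ R S ]′ p))
    closed″ : ∀ {u v} → u ∈ R′ ∩ R → Adj es′ u v → v ∈ R′ ∩ R ⊎ v ∈ S′ ∩ (R ∪ S)
    closed″ p e with ∩⁻ R′ R p
    ... | r′ , r with edge e
    ... | inj₁ e′ = meet (closed′ r′ e′) (closed r e′)
    ... | inj₂ (inj₁ u∈X) = contradiction u∈X (target′ r′)
    ... | inj₂ (inj₂ u∉R) = contradiction r u∉R

  -- Keep `L₁` inside `R ∪ S` and `L₂` outside `R`; the two parts can overlap only in `S`. As `S`
  -- with one more vertex has at most `k` elements, each connected set meets it only in its
  -- endpoint, so clipping there preserves connectedness.
  join-linkages : ∀ {es es′ A B x y k} (s : Separator es A B) → let open Separator s in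
    (∀ {u v} → Adj es u v → Adj es′ u v) → Adj es′ x y → x ∈ R → y ∉ R → y ∉ S → ∣ S ∣ < k →
    Linkage es A (S ∪ ⁅ x ⁆) k → Linkage es B (S ∪ ⁅ y ⁆) k → Linkage es′ A B k
  join-linkages {es} {es′} {A} {B} {x} {y} {k} s incl exy x∈R y∉R y∉S lt L₁ L₂ = record
    { P = Z ; disj = Z-disj
    ; conn = λ i p q → walk-++ (toHub i p) (walk-reverse Adj-sym (toHub i q))
    ; a = L₁.a ; b = λ i → L₂.a (σ i)
    ; a∈P = λ i → ∪⁺ˡ (left i) (right i) (∩⁺ (L₁.P i) (R ∪ S) (L₁.a∈P i) ([ ∪⁺ˡ R S , ∪⁺ʳ R S ]′ (source (L₁.a∈A i))))
    ; b∈P = λ i → ∪⁺ʳ (left i) (right i) (∩⁺ (L₂.P (σ i)) (∁ R) (L₂.a∈P (σ i)) (∁⁺ R λ r → target r (L₂.a∈A (σ i))))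
    ; a∈A = L₁.a∈A ; b∈B = λ i → L₂.a∈A (σ i)
    }
    where
    open Separator s
    module L₁ = Linkage L₁
    module L₂ = Linkage L₂
    X Y : FSet n
    X = S ∪ ⁅ x ⁆
    Y = S ∪ ⁅ y ⁆
    small : ∀ z → ∣ S ∪ ⁅ z ⁆ ∣ ≤ k
    small z = ℕ.≤-trans (∣∪∣≤ S ⁅ z ⁆) (ℕ.≤-trans (ℕ.+-monoʳ-≤ ∣ S ∣ (∣⁅⁆∣≤1 z)) (ℕ.≤-trans (ℕ.≤-reflexive (ℕ.+-comm _ 1)) lt))
    tr₁ = transversal L₁.P X L₁.disj L₁.b L₁.b∈P L₁.b∈B (small x)
    tr₂ = transversal L₂.P Y L₂.disj L₂.b L₂.b∈P L₂.b∈B (small y)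
    -- A path that enters S + x at c continues with the one that ends in the same vertex of S, or in y if c = x.
    σ′ : ∀ c → c ∈ X → ∃[ j ] (L₂.b j ≡ c × c ∈ S ⊎ L₂.b j ≡ y × c ≡ x)
    σ′ c c∈X with ∪⁻ S ⁅ x ⁆ c∈X
    ... | inj₁ c∈S = let j , e = proj₁ tr₂ (∪⁺ˡ S ⁅ y ⁆ c∈S) in j , inj₁ (e , c∈S)
    ... | inj₂ c≡x = let j , e = proj₁ tr₂ (∪⁺ʳ S ⁅ y ⁆ (⁅⁆⁺ y)) in j , inj₂ (e , ⁅⁆⁻ c≡x)
    σ : Fin k → Fin k
    σ i = proj₁ (σ′ (L₁.b i) (L₁.b∈B i))
    σ-spec : ∀ i → (L₂.b (σ i) ≡ L₁.b i × L₁.b i ∈ S) ⊎ (L₂.b (σ i) ≡ y × L₁.b i ≡ x)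
    σ-spec i = proj₂ (σ′ (L₁.b i) (L₁.b∈B i))
    left right Z : Fin k → FSet n
    left i  = L₁.P i ∩ (R ∪ S)
    right i = L₂.P (σ i) ∩ ∁ R
    Z i = left i ∪ right i
    b-inj : ∀ {i j} → L₁.b i ≡ L₁.b j → i ≡ j
    b-inj {i} {j} e = L₁.disj (L₁.b∈P i) (subst (_∈ L₁.P j) (sym e) (L₁.b∈P j))
    σ-inj : ∀ {i j} → σ i ≡ σ j → i ≡ j
    σ-inj {i} {j} e with σ-spec i | σ-spec j
    ... | inj₁ (p , _)  | inj₁ (q , _)  = b-inj (trans (sym p) (trans (cong L₂.b e) q))
    ... | inj₂ (_ , p)  | inj₂ (_ , q)  = b-inj (trans p (sym q))
    ... | inj₁ (p , c∈S) | inj₂ (q , _) = contradiction (subst (_∈ S) (trans (sym p) (trans (cong L₂.b e) q)) c∈S) y∉S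
    ... | inj₂ (p , _) | inj₁ (q , c∈S) = contradiction (subst (_∈ S) (trans (sym q) (trans (cong L₂.b (sym e)) p)) c∈S) y∉S
    cross : ∀ {i j v} → v ∈ left i → v ∈ right j → i ≡ j
    cross {i} {j} {v} p q with ∩⁻ (L₁.P i) (R ∪ S) p | ∩⁻ (L₂.P (σ j)) (∁ R) q
    ... | v∈P , v∈RS | v∈P′ , v∉R with ∪⁻ R S v∈RS
    ... | inj₁ v∈R = contradiction v∈R (∁⁻ R v∉R)
    ... | inj₂ v∈S with σ-spec j
    ... | inj₁ (e , _) = b-inj (trans (sym (proj₂ tr₁ (∪⁺ˡ S ⁅ x ⁆ v∈S) v∈P)) (trans (proj₂ tr₂ (∪⁺ˡ S ⁅ y ⁆ v∈S) v∈P′) e))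
    ... | inj₂ (e , _) = contradiction (subst (_∈ S) (trans (proj₂ tr₂ (∪⁺ˡ S ⁅ y ⁆ v∈S) v∈P′) e) v∈S) y∉S
    Z-disj : ∀ {i j v} → v ∈ Z i → v ∈ Z j → i ≡ j
    Z-disj {i} {j} p q with ∪⁻ (left i) (right i) p | ∪⁻ (left j) (right j) q
    ... | inj₁ p′ | inj₁ q′ = L₁.disj (proj₁ (∩⁻ (L₁.P i) (R ∪ S) p′)) (proj₁ (∩⁻ (L₁.P j) (R ∪ S) q′))
    ... | inj₂ p′ | inj₂ q′ = σ-inj (L₂.disj (proj₁ (∩⁻ (L₂.P (σ i)) (∁ R) p′)) (proj₁ (∩⁻ (L₂.P (σ j)) (∁ R) q′)))
    ... | inj₁ p′ | inj₂ q′ = cross p′ q′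
    ... | inj₂ p′ | inj₁ q′ = sym (cross q′ p′)
    left-walk : ∀ i {u} → u ∈ left i → Walk (Adj es′) (Z i) u (L₁.b i)
    left-walk i p = walk-map incl (∪⁺ˡ (left i) (right i))
      (walk-clip stay (proj₂ p′) (L₁.conn i (proj₁ p′) (L₁.b∈P i)))
      where
      p′ = ∩⁻ (L₁.P i) (R ∪ S) p
      stay : ∀ {u w} → u ∈ L₁.P i → u ∈ R ∪ S → u ≢ L₁.b i → Adj es u w → w ∈ L₁.P i → w ∈ R ∪ S
      stay u∈P u∈RS ne e _ with ∪⁻ R S u∈RS
      ... | inj₁ u∈R = [ ∪⁺ˡ R S , ∪⁺ʳ R S ]′ (closed u∈R e)
      ... | inj₂ u∈S = contradiction (proj₂ tr₁ (∪⁺ˡ S ⁅ x ⁆ u∈S) u∈P) ne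
    right-walk : ∀ i {u} → u ∈ right i → Walk (Adj es′) (Z i) u (L₂.b (σ i))
    right-walk i p = walk-map incl (∪⁺ʳ (left i) (right i))
      (walk-clip stay (proj₂ p′) (L₂.conn (σ i) (proj₁ p′) (L₂.b∈P (σ i))))
      where
      p′ = ∩⁻ (L₂.P (σ i)) (∁ R) p
      stay : ∀ {u w} → u ∈ L₂.P (σ i) → u ∈ ∁ R → u ≢ L₂.b (σ i) → Adj es u w → w ∈ L₂.P (σ i) → w ∈ ∁ R
      stay u∈P u∉R ne e _ = ∁⁺ R λ w∈R → [ ∁⁻ R u∉R , (λ u∈S → ne (proj₂ tr₂ (∪⁺ˡ S ⁅ y ⁆ u∈S) u∈P)) ]′ (closed w∈R (Adj-sym e))
    bridge : ∀ i → L₂.b (σ i) ∈ Z i → L₁.b i ∈ Z i → Walk (Adj es′) (Z i) (L₂.b (σ i)) (L₁.b i)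
    bridge i p q with σ-spec i
    ... | inj₁ (e , _)  = subst (λ c → Walk (Adj es′) (Z i) c (L₁.b i)) (sym e) (stop q)
    ... | inj₂ (e , e′) = go p (subst₂ (Adj es′) (sym e) (sym e′) (Adj-sym exy)) (stop q)
    hub∈Z : ∀ i → L₁.b i ∈ Z i
    hub∈Z i = ∪⁺ˡ (left i) (right i) (∩⁺ (L₁.P i) (R ∪ S) (L₁.b∈P i) (lem (∪⁻ S ⁅ x ⁆ (L₁.b∈B i))))
      where
      lem : ∀ {v} → v ∈ S ⊎ v ∈ ⁅ x ⁆ → v ∈ R ∪ S
      lem (inj₁ q) = ∪⁺ʳ R S q
      lem {v} (inj₂ e) = ∪⁺ˡ R S (subst (_∈ R) (sym (⁅⁆⁻ {x = x} {v} e)) x∈R)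
    toHub : ∀ i {u} → u ∈ Z i → Walk (Adj es′) (Z i) u (L₁.b i)
    toHub i p with ∪⁻ (left i) (right i) p
    ... | inj₁ p′ = left-walk i p′
    ... | inj₂ p′ = let ω = right-walk i p′ in walk-++ ω (bridge i (walk-end ω) (hub∈Z i))

  weaken-linkage : ∀ {es es′ A B k} → (∀ {u v} → Adj es u v → Adj es′ u v) → Linkage es A B k → Linkage es′ A B k
  weaken-linkage incl L = record
    { P = P ; disj = disj ; conn = λ i p q → walk-map incl id (conn i p q)
    ; a = a ; b = b ; a∈P = a∈P ; b∈P = b∈P ; a∈A = a∈A ; b∈B = b∈B }
    where open Linkage L

  -- Only an edge from `R` to a vertex outside `R ∪ S` spoils the separator. If one of the two
  -- linkages is missing, the small separator found instead still separates `A` from `B` once the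
  -- edge is added; the case of `B` reduces to that of `A` by `flip-separator`.
  add-edge : ∀ {es es′ A B k x y} →
    (∀ {u v} → Adj es u v → Adj es′ u v) → Adj es′ x y →
    (∀ {u v} → Adj es′ u v → Adj es u v ⊎ (u ≡ x × v ≡ y) ⊎ (u ≡ y × v ≡ x)) →
    (∀ A B → SmallSeparator es A B k ⊎ Linkage es A B k) →
    (s : Separator es A B) → x ∈ Separator.R s → y ∉ Separator.R s → y ∉ Separator.S s → ∣ Separator.S s ∣ < k →
    SmallSeparator es′ A B k ⊎ Linkage es′ A B k
  add-edge {es} {es′} {A} {B} {k} {x} {y} incl exy only ih s x∈R y∉R y∉S lt
    with ih A (S ∪ ⁅ x ⁆) | ih B (S ∪ ⁅ y ⁆)
    where open Separator s
  ... | inj₁ s₁ | _ = inj₁ (pull-separator s edge (∪⁺ˡ S ⁅ x ⁆) s₁)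
    where
    open Separator s
    edge : ∀ {u v} → Adj es′ u v → Adj es u v ⊎ u ∈ S ∪ ⁅ x ⁆ ⊎ u ∉ R
    edge e with only e
    ... | inj₁ e′ = inj₁ e′
    ... | inj₂ (inj₁ (refl , _)) = inj₂ (inj₁ (∪⁺ʳ S ⁅ x ⁆ (⁅⁆⁺ x)))
    ... | inj₂ (inj₂ (refl , _)) = inj₂ (inj₂ y∉R)
  ... | inj₂ _ | inj₁ s₂ = inj₁ (let s′ , lt′ = pull-separator (flip-separator s) edge (∪⁺ˡ S ⁅ y ⁆) s₂ in flip-separator s′ , lt′)
    where
    open Separator s
    edge : ∀ {u v} → Adj es′ u v → Adj es u v ⊎ u ∈ S ∪ ⁅ y ⁆ ⊎ u ∉ ∁ (R ∪ S)
    edge e with only e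
    ... | inj₁ e′ = inj₁ e′
    ... | inj₂ (inj₁ (refl , _)) = inj₂ (inj₂ λ q → ∁⁻ (R ∪ S) q (∪⁺ˡ R S x∈R))
    ... | inj₂ (inj₂ (refl , _)) = inj₂ (inj₁ (∪⁺ʳ S ⁅ y ⁆ (⁅⁆⁺ y)))
  ... | inj₂ L₁ | inj₂ L₂ = inj₂ (join-linkages s incl exy x∈R y∉R y∉S lt L₁ L₂)

  -- Göring's proof: if deleting the edge xy creates a separator S of size k ∸ 1, then
  -- k paths from A to S + x and k paths from S + y to B combine through xy.
  menger : ∀ es A B k → SmallSeparator es A B k ⊎ Linkage es A B k
  menger [] A B k with k ≤? ∣ A ∩ B ∣
  ... | no lt = inj₁ (record
    { S = A ∩ B ; R = A ∖ B
    ; source = source ; target = λ p → proj₂ (∖⁻ A B p)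
    ; RS = λ p q → proj₂ (∖⁻ A B p) (proj₂ (∩⁻ A B q))
    ; closed = λ { _ (inj₁ ()) ; _ (inj₂ ()) } } , ℕ.≰⇒> lt)
    where
    source : ∀ {v} → v ∈ A → v ∈ A ∖ B ⊎ v ∈ A ∩ B
    source {v} p with v ∈? B
    ... | yes q = inj₂ (∩⁺ A B p q)
    ... | no ¬q = inj₁ (∖⁺ A B p ¬q)
  ... | yes le = let f , inj , f∈ = choose (A ∩ B) le in inj₂ (record
    { P = ⁅_⁆ ∘ f ; disj = λ {i} {j} {v} p q → inj (trans (sym (⁅⁆⁻ {x = f i} {v} p)) (⁅⁆⁻ q))
    ; conn = λ i p q → subst₂ (Walk (Adj []) ⁅ f i ⁆) (sym (⁅⁆⁻ p)) (sym (⁅⁆⁻ q)) (stop (⁅⁆⁺ (f i)))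
    ; a = f ; b = f ; a∈P = ⁅⁆⁺ ∘ f ; b∈P = ⁅⁆⁺ ∘ f
    ; a∈A = proj₁ ∘ ∩⁻ A B ∘ f∈ ; b∈B = proj₂ ∘ ∩⁻ A B ∘ f∈ })
  menger ((x , y) ∷ es) A B k with menger es A B k
  ... | inj₂ L = inj₂ (weaken-linkage Adj-there L)
  ... | inj₁ (s , lt) = cases (x ∈? R) (y ∈? R) (x ∈? S) (y ∈? S)
    where
    open Separator s
    es′ = (x , y) ∷ es
    only : ∀ {u v} → Adj es′ u v → Adj es u v ⊎ (u ≡ x × v ≡ y) ⊎ (u ≡ y × v ≡ x)
    only (inj₁ (here refl)) = inj₂ (inj₁ (refl , refl))
    only (inj₁ (there e))   = inj₁ (inj₁ e)
    only (inj₂ (here refl)) = inj₂ (inj₂ (refl , refl))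
    only (inj₂ (there e))   = inj₁ (inj₂ e)
    keep : (x ∈ R → y ∈ R ⊎ y ∈ S) → (y ∈ R → x ∈ R ⊎ x ∈ S) → SmallSeparator es′ A B k
    keep f g = record { S = S ; R = R ; source = source ; target = target ; RS = RS ; closed = closed′ } , lt
      where
      closed′ : ∀ {u v} → u ∈ R → Adj es′ u v → v ∈ R ⊎ v ∈ S
      closed′ r e with only e
      ... | inj₁ e′ = closed r e′
      ... | inj₂ (inj₁ (refl , refl)) = f r
      ... | inj₂ (inj₂ (refl , refl)) = g r
    cases : Dec (x ∈ R) → Dec (y ∈ R) → Dec (x ∈ S) → Dec (y ∈ S) → SmallSeparator es′ A B k ⊎ Linkage es′ A B k
    cases (yes a) (yes b) _ _ = inj₁ (keep (λ _ → inj₁ b) (λ _ → inj₁ a))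
    cases (no a)  (no b)  _ _ = inj₁ (keep (λ r → contradiction r a) (λ r → contradiction r b))
    cases (yes a) (no b)  _ (yes d) = inj₁ (keep (λ _ → inj₂ d) (λ r → contradiction r b))
    cases (no a)  (yes b) (yes c) _ = inj₁ (keep (λ r → contradiction r a) (λ _ → inj₂ c))
    cases (yes a) (no b)  _ (no d) = add-edge Adj-there (inj₁ (here refl)) only (λ A B → menger es A B k) s a b d lt
    cases (no a)  (yes b) (no c) _ = add-edge Adj-there (inj₂ (here refl)) ([ inj₁ , inj₂ ∘ [ inj₂ , inj₁ ]′ ]′ ∘ only) (λ A B → menger es A B k) s b a c lt

-- Chains of separators

-- Bounded choice as a total function, so that families of sets need not carry proofs of `r ≤ R`;
-- `x₀` is the value beyond `R`.
tabulate≤ : ∀ {X : Set} {Q : ℕ → X → Set} (R : ℕ) → X → (∀ r → r ≤ R → ∃ (Q r)) → Σ (ℕ → X) λ f → ∀ r → r ≤ R → Q r (f r)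
tabulate≤ {X} {Q} R x₀ h = f , f-spec
  where
  f : ℕ → X
  f r with r ≤? R
  ... | yes p = proj₁ (h r p)
  ... | no _  = x₀
  f-spec : ∀ r → r ≤ R → Q r (f r)
  f-spec r p with r ≤? R
  ... | yes q = proj₂ (h r q)
  ... | no ¬q = contradiction p ¬q

search≤ : ∀ {P Q : ℕ → Set} R → (∀ r → P r ⊎ Q r) → (∃[ r ] (r ≤ R × P r)) ⊎ (∀ r → r ≤ R → Q r)
search≤ zero f with f zero
... | inj₁ p = inj₁ (zero , z≤n , p)
... | inj₂ q = inj₂ λ { zero z≤n → q }
search≤ (suc R) f with f (suc R)
... | inj₁ p = inj₁ (suc R , ℕ.≤-refl , p)
... | inj₂ q with search≤ R f
...   | inj₁ (r , le , p) = inj₁ (r , ℕ.m≤n⇒m≤1+n le , p)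
...   | inj₂ h = inj₂ λ r le → case ℕ.m≤n⇒m<n∨m≡n le of λ { (inj₁ (s≤s lt)) → h r lt ; (inj₂ refl) → q }

-- refine thins a chain out by the factor ℓ + 1, where ℓ = len s k, and needs room for ℓ + 1 blocks of
-- s + 1 separators each after that.
coarse : ℕ → ℕ → ℕ
coarse s ℓ = ℓ * suc s + s

len : ℕ → ℕ → ℕ
len s zero    = s
len s (suc k) = suc (coarse s (len s k)) * suc (len s k)

module Chains {n : ℕ} (F : Fin n → Fin n → Bool) (F-sym : ∀ {u v} → F u v ≡ true → F v u ≡ true) (top : FSet n) where

  E : Rel n
  E u v = F u v ≡ true

  -- The vertices a are common to all separators of the chain; B i holds the others.
  record Chain {α} (a : Fin α → Fin n) (k L : ℕ) : Set where
    field
      D B    : ℕ → FSet n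
      closed : ∀ {i u v} → i ≤ L → u ∈ D i → E u v → v ∈ D i ⊎ v ∈ B i ⊎ ∃[ q ] a q ≡ v
      DB     : ∀ {i v} → i ≤ L → v ∈ D i → v ∉ B i
      Da     : ∀ {i} q → i ≤ L → a q ∉ D i
      Ba     : ∀ {i} q → i ≤ L → a q ∉ B i
      D⊆     : ∀ {i j v} → i ≤ j → j ≤ L → v ∈ D j → v ∈ D i
      B⊆     : ∀ {i j v} → i ≤ j → j ≤ L → v ∈ B j → v ∈ D i ⊎ v ∈ B i
      -- Makes the region between two separators non-empty, so that it can be tested as an island.
      gap    : ∀ {i j} → i < j → j ≤ L → ∃[ v ] (v ∈ D i × v ∉ D j × v ∉ B j)
      small  : ∀ {i} → i ≤ L → ∣ B i ∣ ≤ k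
      inTop  : ∀ {v} → v ∈ D 0 → v ∈ top

    -- Otherwise the vertex would lie strictly below separator `j`, hence strictly below separator
    -- `i`, on which it lies. So a vertex found at both ends of a block is on every separator of the
    -- block.
    B-interval : ∀ {i j l v} → i ≤ j → j ≤ l → l ≤ L → v ∈ B i → v ∈ B l → v ∈ B j
    B-interval i≤j j≤l l≤L p q with B⊆ j≤l l≤L q
    ... | inj₂ r = r
    ... | inj₁ r = contradiction p (DB (ℕ.≤-trans i≤j (ℕ.≤-trans j≤l l≤L)) (D⊆ i≤j (ℕ.≤-trans j≤l l≤L) r))

  Disjoint : ∀ {α} {a : Fin α → Fin n} {k L} → Chain a k L → Set
  Disjoint {L = L} c = ∀ {i j v} → i < j → j ≤ L → v ∈ Chain.B c i → v ∉ Chain.B c j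

  reindex : ∀ {α} {a : Fin α → Fin n} {k L} (L′ : ℕ) (f : ℕ → ℕ) → (∀ {i j} → i < j → f i < f j) → f L′ ≤ L →
    Chain a k L → Chain a k L′
  reindex {L = L} L′ f f-mono fL c = record
    { D = D ∘ f ; B = B ∘ f ; closed = closed ∘ ok ; DB = DB ∘ ok ; Da = λ q → Da q ∘ ok ; Ba = λ q → Ba q ∘ ok
    ; D⊆ = λ le le′ → D⊆ (f-≤ le) (ok le′) ; B⊆ = λ le le′ → B⊆ (f-≤ le) (ok le′)
    ; gap = λ lt le → gap (f-mono lt) (ok le) ; small = small ∘ ok ; inTop = inTop ∘ D⊆ z≤n (ok z≤n) }
    where
    open Chain c
    f-≤ : ∀ {i j} → i ≤ j → f i ≤ f j
    f-≤ le = case ℕ.m≤n⇒m<n∨m≡n le of λ { (inj₁ lt) → ℕ.<⇒≤ (f-mono lt) ; (inj₂ refl) → ℕ.≤-refl }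
    ok : ∀ {i} → i ≤ L′ → f i ≤ L
    ok le = ℕ.≤-trans (f-≤ le) fL

  -- By `B-interval` the vertex is on all separators of the block; declaring it common lowers their
  -- order by one.
  fix-vertex : ∀ {α} {a : Fin α → Fin n} {k L ℓ} (c : Chain a (suc k) L) → let open Chain c in
    ∀ i {v} → i + ℓ ≤ L → v ∈ B i → v ∈ B (i + ℓ) → Chain (v Vector.∷ a) k ℓ
  fix-vertex {a = a} {k} {L} {ℓ} c i {v} le p q = record
    { D = D ∘ (i +_) ; B = λ l → B (i + l) ∖ ⁅ v ⁆
    ; closed = closed′
    ; DB = λ le d b → DB (ok le) d (proj₁ (∖⁻ (B _) ⁅ v ⁆ b))
    ; Da = λ { zero le d → DB (ok le) d (stays le) ; (suc r) le → Da r (ok le) }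
    ; Ba = λ { zero le b → proj₂ (∖⁻ (B _) ⁅ v ⁆ b) (⁅⁆⁺ v) ; (suc r) le b → Ba r (ok le) (proj₁ (∖⁻ (B _) ⁅ v ⁆ b)) }
    ; D⊆ = λ le le′ → D⊆ (ℕ.+-monoʳ-≤ i le) (ok le′)
    ; B⊆ = B⊆′
    ; gap = λ lt le → let u , x , y , z = gap (ℕ.+-monoʳ-< i lt) (ok le) in u , x , y , z ∘ proj₁ ∘ ∖⁻ (B _) ⁅ v ⁆
    ; small = small′
    ; inTop = inTop ∘ D⊆ z≤n (ok z≤n)
    }
    where
    open Chain c
    ok : ∀ {l} → l ≤ ℓ → i + l ≤ L
    ok l≤ = ℕ.≤-trans (ℕ.+-monoʳ-≤ i l≤) le
    stays : ∀ {l} → l ≤ ℓ → v ∈ B (i + l)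
    stays l≤ = B-interval (ℕ.m≤m+n i _) (ℕ.+-monoʳ-≤ i l≤) le p q
    split : ∀ {l u} → u ∈ B l → u ∈ B l ∖ ⁅ v ⁆ ⊎ v ≡ u
    split {l} {u} b with u ∈? ⁅ v ⁆
    ... | yes e = inj₂ (sym (⁅⁆⁻ e))
    ... | no ne = inj₁ (∖⁺ (B l) ⁅ v ⁆ b ne)
    closed′ : ∀ {l u w} → l ≤ ℓ → u ∈ D (i + l) → E u w → w ∈ D (i + l) ⊎ w ∈ B (i + l) ∖ ⁅ v ⁆ ⊎ ∃[ q ] (v Vector.∷ a) q ≡ w
    closed′ {l} l≤ d e with closed (ok l≤) d e
    ... | inj₁ x = inj₁ x
    ... | inj₂ (inj₂ (r , x)) = inj₂ (inj₂ (suc r , x))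
    ... | inj₂ (inj₁ b) with split {i + l} b
    ...   | inj₁ x = inj₂ (inj₁ x)
    ...   | inj₂ x = inj₂ (inj₂ (zero , x))
    B⊆′ : ∀ {l l′ u} → l ≤ l′ → l′ ≤ ℓ → u ∈ B (i + l′) ∖ ⁅ v ⁆ → u ∈ D (i + l) ⊎ u ∈ B (i + l) ∖ ⁅ v ⁆
    B⊆′ {l} {l′} le₁ le₂ b with ∖⁻ (B (i + l′)) ⁅ v ⁆ b
    ... | b′ , ne with B⊆ (ℕ.+-monoʳ-≤ i le₁) (ok le₂) b′
    ...   | inj₁ x = inj₁ x
    ...   | inj₂ x = inj₂ (∖⁺ (B (i + l)) ⁅ v ⁆ x ne)
    small′ : ∀ {l} → l ≤ ℓ → ∣ B (i + l) ∖ ⁅ v ⁆ ∣ ≤ k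
    small′ {l} l≤ with suc k ≤? ∣ B (i + l) ∖ ⁅ v ⁆ ∣
    ... | no lt = ℕ.≤-pred (ℕ.≰⇒> lt)
    ... | yes ge with choose (B (i + l) ∖ ⁅ v ⁆) ge
    ...   | f , inj , f∈ with injection-onto (B (i + l)) f inj (proj₁ ∘ ∖⁻ (B (i + l)) ⁅ v ⁆ ∘ f∈) (small (ok l≤)) (stays l≤)
    ...     | r , e = contradiction (subst (_∈ ⁅ v ⁆) (sym e) (⁅⁆⁺ v)) (proj₂ (∖⁻ (B (i + l)) ⁅ v ⁆ (f∈ r)))

  module _ {α} {a : Fin α → Fin n} {k L : ℕ} (c : Chain a k L) where
    open Chain c
    open Menger {n}

    between : ℕ → ℕ → FSet n
    between i j = (D i ∪ B i) ∖ D j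

    inside? : ∀ i j (e : Fin n × Fin n) → Dec (F (proj₁ e) (proj₂ e) ≡ true × proj₁ e ∈ between i j × proj₂ e ∈ between i j)
    inside? i j (u , v) = (F u v 𝔹.≟ true) ×-dec (u ∈? between i j) ×-dec (v ∈? between i j)

    -- Menger's theorem is applied to these edges only, which confines the linkage to the block and
    -- keeps it away from the common vertices.
    edgesBetween : ℕ → ℕ → List (Fin n × Fin n)
    edgesBetween i j = filter (inside? i j) (cartesianProduct (allFin n) (allFin n))

    edgesBetween⁺ : ∀ i j {u v} → E u v → u ∈ between i j → v ∈ between i j → Adj (edgesBetween i j) u v
    edgesBetween⁺ i j {u} {v} e p q = inj₁ (∈-filter⁺ (inside? i j) (∈-cartesianProduct⁺ (∈-allFin u) (∈-allFin v)) (e , p , q))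

    edgesBetween⁻ : ∀ i j {u v} → Adj (edgesBetween i j) u v → E u v × u ∈ between i j × v ∈ between i j
    edgesBetween⁻ i j (inj₁ m) = proj₂ (∈-filter⁻ (inside? i j) {xs = cartesianProduct (allFin n) (allFin n)} m)
    edgesBetween⁻ i j (inj₂ m) =
      let e , p , q = proj₂ (∈-filter⁻ (inside? i j) {xs = cartesianProduct (allFin n) (allFin n)} m) in F-sym e , q , p

    between⁺ : ∀ {i j v} → v ∈ D i ⊎ v ∈ B i → v ∉ D j → v ∈ between i j
    between⁺ {i} {j} p q = ∖⁺ (D i ∪ B i) (D j) ([ ∪⁺ˡ (D i) (B i) , ∪⁺ʳ (D i) (B i) ]′ p) q

    between⁻ : ∀ {i j v} → v ∈ between i j → (v ∈ D i ⊎ v ∈ B i) × v ∉ D j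
    between⁻ {i} {j} p = let x , y = ∖⁻ (D i ∪ B i) (D j) p in ∪⁻ (D i) (B i) x , y

    -- A separator of order below `k` wedged between the `i`-th and the `j`-th, with all that is
    -- needed to make it a member of a new chain.
    Cut : ℕ → ℕ → FSet n × FSet n → Set
    Cut i j (D′ , B′) =
      (∀ {u v} → u ∈ D′ → E u v → v ∈ D′ ⊎ v ∈ B′ ⊎ ∃[ q ] a q ≡ v) ×
      (∀ {v} → v ∈ D′ → v ∉ B′) ×
      (∀ {v} → v ∈ D′ → v ∈ D i) ×
      (∀ {v} → v ∈ B′ → v ∈ D i ⊎ v ∈ B i) ×
      (∀ {v} → v ∈ D j → v ∈ D′) ×
      (∀ {v} → v ∈ B j → v ∈ D′ ⊎ v ∈ B′) ×
      ∣ B′ ∣ < k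

    -- The new lower side is `D j` together with the part of the region outside `R ∪ S`. An edge
    -- from that part into `R` would, read backwards, put its start into `R ∪ S`.
    separator⇒cut : ∀ {i j} → i ≤ j → j ≤ L → SmallSeparator (edgesBetween i j) (B i) (B j) k → ∃ (Cut i j)
    separator⇒cut {i} {j} i≤j j≤L (s , lt) = (D′ , B′) , closed′ , DB′ , inner , innerB , ∪⁺ˡ (D j) M , outerB ,
      ℕ.≤-<-trans (∣∣-mono B′ S (proj₁ ∘ ∩⁻ S W)) lt
      where
      open Separator s renaming (closed to s-closed)
      W M D′ B′ : FSet n
      W = between i j
      M = W ∖ (R ∪ S)
      D′ = D j ∪ M
      B′ = S ∩ W
      i≤L = ℕ.≤-trans i≤j j≤L
      M⊆D : ∀ {v} → v ∈ M → v ∈ D i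
      M⊆D p with ∖⁻ W (R ∪ S) p
      ... | w , nrs with proj₁ (between⁻ {i} {j} w)
      ...   | inj₁ d = d
      ...   | inj₂ b = contradiction ([ ∪⁺ˡ R S , ∪⁺ʳ R S ]′ (source b)) nrs
      inner : ∀ {v} → v ∈ D′ → v ∈ D i
      inner p = [ D⊆ i≤j j≤L , M⊆D ]′ (∪⁻ (D j) M p)
      innerB : ∀ {v} → v ∈ B′ → v ∈ D i ⊎ v ∈ B i
      innerB p = proj₁ (between⁻ {i} {j} (proj₂ (∩⁻ S W p)))
      DB′ : ∀ {v} → v ∈ D′ → v ∉ B′
      DB′ p q with ∩⁻ S W q | ∪⁻ (D j) M p
      ... | _ , w | inj₁ d = proj₂ (between⁻ {i} {j} w) d
      ... | s∈ , _ | inj₂ m = proj₂ (∖⁻ W (R ∪ S) m) (∪⁺ʳ R S s∈)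
      place : ∀ {v} → v ∈ W → v ∉ R → v ∈ D′ ⊎ v ∈ B′
      place {v} w ¬r with v ∈? S
      ... | yes s∈ = inj₂ (∩⁺ S W s∈ w)
      ... | no ¬s = inj₁ (∪⁺ʳ (D j) M (∖⁺ W (R ∪ S) w ([ ¬r , ¬s ]′ ∘ ∪⁻ R S)))
      outerB : ∀ {v} → v ∈ B j → v ∈ D′ ⊎ v ∈ B′
      outerB b = place (between⁺ {i} {j} (B⊆ i≤j j≤L b) (λ d → DB j≤L d b)) (λ r → target r b)
      closed′ : ∀ {u v} → u ∈ D′ → E u v → v ∈ D′ ⊎ v ∈ B′ ⊎ ∃[ q ] a q ≡ v
      closed′ p e with ∪⁻ (D j) M p
      closed′ p e | inj₁ d with closed j≤L d e
      ... | inj₁ x = inj₁ (∪⁺ˡ (D j) M x)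
      ... | inj₂ (inj₁ b) = [ inj₁ , inj₂ ∘ inj₁ ]′ (outerB b)
      ... | inj₂ (inj₂ x) = inj₂ (inj₂ x)
      closed′ {u} {v} p e | inj₂ m with closed i≤L (M⊆D m) e | v ∈? D j
      ... | _ | yes d = inj₁ (∪⁺ˡ (D j) M d)
      ... | inj₂ (inj₂ x) | _ = inj₂ (inj₂ x)
      ... | inj₁ x | no ¬d = [ inj₁ , inj₂ ∘ inj₁ ]′ (place (between⁺ {i} {j} (inj₁ x) ¬d) (¬R (between⁺ {i} {j} (inj₁ x) ¬d)))
        where
        ¬R : v ∈ W → v ∉ R
        ¬R w r = let w′ , nrs = ∖⁻ W (R ∪ S) m in nrs ([ ∪⁺ˡ R S , ∪⁺ʳ R S ]′ (s-closed r (edgesBetween⁺ i j (F-sym e) w w′)))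
      ... | inj₂ (inj₁ x) | no ¬d = [ inj₁ , inj₂ ∘ inj₁ ]′ (place (between⁺ {i} {j} (inj₂ x) ¬d) (¬R (between⁺ {i} {j} (inj₂ x) ¬d)))
        where
        ¬R : v ∈ W → v ∉ R
        ¬R w r = let w′ , nrs = ∖⁻ W (R ∪ S) m in nrs ([ ∪⁺ˡ R S , ∪⁺ʳ R S ]′ (s-closed r (edgesBetween⁺ i j (F-sym e) w w′)))

    -- An edge into `D l` can start only in `D l`, in `B l` or at a common vertex; the last is ruled
    -- out, so the walk enters through `B l`.
    cross : ∀ {P : FSet n} {l u v} → l ≤ L → (∀ {x} → x ∈ P → ∀ q → a q ≢ x) →
      Walk E P u v → u ∉ D l → v ∈ D l ⊎ v ∈ B l → ∃[ x ] (x ∈ P × x ∈ B l)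
    cross {l = l} {u} l≤L noA ω ¬d target with u ∈? B l
    cross l≤L noA ω ¬d target | yes b = _ , walk-start ω , b
    cross l≤L noA (stop p) ¬d (inj₁ d) | no ¬b = contradiction d ¬d
    cross l≤L noA (stop p) ¬d (inj₂ b) | no ¬b = contradiction b ¬b
    cross l≤L noA (go p e ω) ¬d target | no ¬b = cross l≤L noA ω ¬d′ target
      where
      ¬d′ = λ d → case closed l≤L d (F-sym e) of λ { (inj₁ x) → ¬d x ; (inj₂ (inj₁ x)) → ¬b x ; (inj₂ (inj₂ (q , x))) → noA p q x }

  -- Fixing a vertex trades one unit of `k` for one of `α`, so `α + k` never exceeds the order `b`
  -- of the original separators. It is the number of strands.
  record Linked (b s : ℕ) : Set where
    field
      {α}      : ℕ
      a        : Fin α → Fin n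
      k        : ℕ
      bound    : α + k ≤ b
      a-inj    : Inj a
      chain    : Chain a k s
      disjoint : Disjoint chain
    open Chain chain public
    field
      P        : Fin k → FSet n
      P-disj   : ∀ {i j v} → v ∈ P i → v ∈ P j → i ≡ j
      P-conn   : ∀ q → Connected E (P q)
      P-a      : ∀ {q x} → x ∈ P q → ∀ r → a r ≢ x
      hit      : ∀ q {l} → l ≤ s → ∃[ x ] (x ∈ P q × x ∈ B l)
      cover    : ∀ {l z} → l ≤ s → z ∈ B l → ∃[ q ] z ∈ P q
      unique   : ∀ {q l x y} → l ≤ s → x ∈ P q → y ∈ P q → x ∈ B l → y ∈ B l → x ≡ y

  -- A linkage between the end separators of a block crosses every separator inside by `cross`, and
  -- by `transversal` in exactly one vertex per set.
  linkage⇒linked : ∀ {α} {a : Fin α → Fin n} {k L b s} i → α + k ≤ b → Inj a → (c : Chain a k L) → Disjoint c → i + s ≤ L →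
    let open Chain c in Menger.Linkage (edgesBetween c i (i + s)) (B i) (B (i + s)) k → Linked b s
  linkage⇒linked {α} {a} {k} {L} {b} {s} i bd a-inj c disj le L₀ = record
    { a = a ; k = k ; bound = bd ; a-inj = a-inj
    ; chain = reindex s (i +_) (ℕ.+-monoʳ-< i) le c
    ; disjoint = λ lt le′ → disj (ℕ.+-monoʳ-< i lt) (ok le′)
    ; P = L₀.P ; P-disj = L₀.disj ; P-conn = λ q p p′ → walk-map (proj₁ ∘ edgesBetween⁻ c i j) id (L₀.conn q p p′)
    ; P-a = P-a ; hit = hit
    ; cover = λ l≤ z∈B → let q , e = proj₁ (tr l≤) z∈B in q , subst (_∈ L₀.P q) e (proj₁ (proj₂ (hit q l≤)))
    ; unique = λ l≤ x∈P y∈P x∈B y∈B → trans (proj₂ (tr l≤) x∈B x∈P) (sym (proj₂ (tr l≤) y∈B y∈P)) }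
    where
    open Chain c
    j = i + s
    module L₀ = Menger.Linkage L₀
    ok : ∀ {l} → l ≤ s → i + l ≤ L
    ok l≤ = ℕ.≤-trans (ℕ.+-monoʳ-≤ i l≤) le
    i≤L : i ≤ L
    i≤L = ℕ.≤-trans (ℕ.m≤m+n i s) le
    a-between : ∀ q → L₀.a q ∈ between c i j
    a-between q = between⁺ c {i} {j} (inj₂ (L₀.a∈A q)) λ d → DB i≤L (D⊆ (ℕ.m≤m+n i s) le d) (L₀.a∈A q)
    P⊆between : ∀ q {x} → x ∈ L₀.P q → x ∈ between c i j
    P⊆between q p = walk-closed (λ _ _ e _ → proj₂ (proj₂ (edgesBetween⁻ c i j e))) (a-between q) (L₀.conn q (L₀.a∈P q) p)
    P-a : ∀ {q x} → x ∈ L₀.P q → ∀ r → a r ≢ x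
    P-a {q} p r refl = [ Da r i≤L , Ba r i≤L ]′ (proj₁ (between⁻ c {i} {j} (P⊆between q p)))
    hit : ∀ q {l} → l ≤ s → ∃[ x ] (x ∈ L₀.P q × x ∈ B (i + l))
    hit q l≤ = cross c (ok l≤) P-a (walk-map (proj₁ ∘ edgesBetween⁻ c i j) id (L₀.conn q (L₀.a∈P q) (L₀.b∈P q)))
      (λ d → DB i≤L (D⊆ (ℕ.m≤m+n i _) (ok l≤) d) (L₀.a∈A q))
      (B⊆ (ℕ.+-monoʳ-≤ i l≤) le (L₀.b∈B q))
    tr : ∀ {l} (l≤ : l ≤ s) → (∀ {z} → z ∈ B (i + l) → ∃[ q ] proj₁ (hit q l≤) ≡ z) × (∀ {q z} → z ∈ B (i + l) → z ∈ L₀.P q → z ≡ proj₁ (hit q l≤))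
    tr {l} l≤ = transversal L₀.P (B (i + l)) L₀.disj (λ q → proj₁ (hit q l≤)) (λ q → proj₁ (proj₂ (hit q l≤)))
      (λ q → proj₂ (proj₂ (hit q l≤))) (small (ok l≤))

  -- Cuts of different blocks are compared through the old separators `hi r` and `lo r′` between
  -- them. Since `hi r < lo r′` is strict, the old gap between these two survives as a gap between
  -- the cuts.
  cuts⇒chain : ∀ {α} {a : Fin α → Fin n} {k L} (R : ℕ) (lo hi : ℕ → ℕ) → (∀ r → lo r ≤ hi r) → (∀ {r r′} → r < r′ → hi r < lo r′) → hi R ≤ L →
    (c : Chain a (suc k) L) (f : ℕ → FSet n × FSet n) → (∀ r → r ≤ R → Cut c (lo r) (hi r) (f r)) → Chain a k R
  cuts⇒chain {a = a} {k} {L} R lo hi lo≤hi hi<lo hiR c f cut = record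
    { D = D′ ; B = B′
    ; closed = λ {r} le → let cl , _ = cut r le in cl
    ; DB = λ {r} le → let _ , x , _ = cut r le in x
    ; Da = λ {r} q le d → Da q (lo≤L le) (inner le d)
    ; Ba = λ {r} q le b → [ Da q (lo≤L le) , Ba q (lo≤L le) ]′ (innerB le b)
    ; D⊆ = D⊆′ ; B⊆ = B⊆′
    ; gap = λ {r} {r′} lt le → let v , x , y , z = gap (hi<lo lt) (lo≤L le) in
        v , outer (ℕ.≤-trans (ℕ.<⇒≤ lt) le) x , y ∘ inner le , [ y , z ]′ ∘ innerB le
    ; small = λ {r} le → let _ , _ , _ , _ , _ , _ , x = cut r le in ℕ.≤-pred x
    ; inTop = λ d → inTop (D⊆ z≤n (lo≤L z≤n) (inner z≤n d)) }
    where
    open Chain c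
    D′ B′ : ℕ → FSet n
    D′ r = proj₁ (f r)
    B′ r = proj₂ (f r)
    hi-≤ : ∀ {r r′} → r ≤ r′ → hi r ≤ hi r′
    hi-≤ le = case ℕ.m≤n⇒m<n∨m≡n le of λ { (inj₁ lt) → ℕ.≤-trans (ℕ.<⇒≤ (hi<lo lt)) (lo≤hi _) ; (inj₂ refl) → ℕ.≤-refl }
    hi≤L : ∀ {r} → r ≤ R → hi r ≤ L
    hi≤L le = ℕ.≤-trans (hi-≤ le) hiR
    lo≤L : ∀ {r} → r ≤ R → lo r ≤ L
    lo≤L le = ℕ.≤-trans (lo≤hi _) (hi≤L le)
    inner : ∀ {r v} → r ≤ R → v ∈ D′ r → v ∈ D (lo r)
    inner {r} le = let _ , _ , x , _ = cut r le in x
    innerB : ∀ {r v} → r ≤ R → v ∈ B′ r → v ∈ D (lo r) ⊎ v ∈ B (lo r)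
    innerB {r} le = let _ , _ , _ , x , _ = cut r le in x
    outer : ∀ {r v} → r ≤ R → v ∈ D (hi r) → v ∈ D′ r
    outer {r} le = let _ , _ , _ , _ , x , _ = cut r le in x
    outerB : ∀ {r v} → r ≤ R → v ∈ B (hi r) → v ∈ D′ r ⊎ v ∈ B′ r
    outerB {r} le = let _ , _ , _ , _ , _ , x , _ = cut r le in x
    D⊆′ : ∀ {r r′ v} → r ≤ r′ → r′ ≤ R → v ∈ D′ r′ → v ∈ D′ r
    D⊆′ le le′ d with ℕ.m≤n⇒m<n∨m≡n le
    ... | inj₁ lt   = outer (ℕ.≤-trans le le′) (D⊆ (ℕ.<⇒≤ (hi<lo lt)) (lo≤L le′) (inner le′ d))
    ... | inj₂ refl = d
    B⊆′ : ∀ {r r′ v} → r ≤ r′ → r′ ≤ R → v ∈ B′ r′ → v ∈ D′ r ⊎ v ∈ B′ r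
    B⊆′ {r} {r′} le le′ b with ℕ.m≤n⇒m<n∨m≡n le
    ... | inj₂ refl = inj₂ b
    ... | inj₁ lt with innerB le′ b
    ...   | inj₁ d  = inj₁ (outer (ℕ.≤-trans le le′) (D⊆ (ℕ.<⇒≤ (hi<lo lt)) (lo≤L le′) d))
    ...   | inj₂ b′ = [ inj₁ ∘ outer (ℕ.≤-trans le le′) , outerB (ℕ.≤-trans le le′) ]′ (B⊆ (ℕ.<⇒≤ (hi<lo lt)) (lo≤L le′) b′)

  -- A vertex that stays for long becomes a common vertex. Otherwise the thinned separators are disjoint, and
  -- either one block is linked or every block has a separator of order at most k; these form a chain again.
  refine : ∀ s {b} k {α} {a : Fin α → Fin n} → α + k ≤ b → Inj a → Chain a k (len s k) → Linked b s
  -- Separators of order 0 are empty, and the empty family links them.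
  refine s zero bd a-inj c = linkage⇒linked 0 bd a-inj c (λ lt le p _ → B-empty (ℕ.≤-trans (ℕ.<⇒≤ lt) le) p) ℕ.≤-refl record
    { P = λ () ; disj = λ { {()} } ; conn = λ () ; a = λ () ; b = λ () ; a∈P = λ () ; b∈P = λ () ; a∈A = λ () ; b∈B = λ () }
    where
    open Chain c
    B-empty : ∀ {i v} → i ≤ s → v ∉ B i
    B-empty {i} le p = contradiction (small le) (ℕ.<⇒≱ (∈⇒0<∣∣ (B i) p))
  refine s {b} (suc k) {α} {a} bd a-inj c = by-shared (search≤ N shared?)
    where
    open Chain c
    open Menger {n}
    ℓ N st : ℕ
    ℓ  = len s k
    N  = coarse s ℓ
    st = suc ℓ
    Shared : ℕ → Set
    Shared i = ∃[ v ] (v ∈ B (i * st) × v ∈ B (i * st + ℓ))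
    shared? : ∀ i → Shared i ⊎ (¬ Shared i)
    shared? i with Fin.any? (λ v → (v ∈? B (i * st)) ×-dec (v ∈? B (i * st + ℓ)))
    ... | yes p = inj₁ p
    ... | no ¬p = inj₂ ¬p
    st-mono : ∀ {i j} → i < j → i * st < j * st
    st-mono = ℕ.*-monoˡ-< st
    fits : ∀ {i} → i ≤ N → i * st + ℓ ≤ suc N * st
    fits {i} le = ℕ.≤-trans (ℕ.≤-reflexive (ℕ.+-comm (i * st) ℓ)) (ℕ.+-mono-≤ (ℕ.n≤1+n ℓ) (ℕ.*-monoˡ-≤ st le))
    c′ : Chain a (suc k) N
    c′ = reindex N (_* st) st-mono (ℕ.*-monoˡ-≤ st (ℕ.n≤1+n N)) c
    by-blocks : Disjoint c′ → Linked b s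
    by-blocks disj with search≤ ℓ (λ r → let i = r * suc s in [ inj₂ , inj₁ ]′ (menger (edgesBetween c′ i (i + s)) (Chain.B c′ i) (Chain.B c′ (i + s)) (suc k)))
    ... | inj₁ (r , le , L) = linkage⇒linked (r * suc s) bd a-inj c′ disj (ℕ.+-monoˡ-≤ s (ℕ.*-monoˡ-≤ (suc s) le)) L
    ... | inj₂ h = refine s k (ℕ.≤-trans (ℕ.+-monoʳ-≤ α (ℕ.n≤1+n k)) bd) a-inj
      (let f , f-cut = tabulate≤ ℓ (B 0 , B 0) (λ r le → separator⇒cut c′ (ℕ.m≤m+n _ s) (ℕ.+-monoˡ-≤ s (ℕ.*-monoˡ-≤ (suc s) le)) (h r le))
       in cuts⇒chain ℓ (_* suc s) (λ r → r * suc s + s) (λ r → ℕ.m≤m+n _ s) hi<lo ℕ.≤-refl c′ f f-cut)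
      where
      hi<lo : ∀ {r r′} → r < r′ → r * suc s + s < r′ * suc s
      hi<lo {r} lt = ℕ.≤-trans (ℕ.≤-reflexive (trans (sym (ℕ.+-suc (r * suc s) s)) (ℕ.+-comm (r * suc s) (suc s)))) (ℕ.*-monoˡ-≤ (suc s) lt)
    by-shared : (∃[ i ] (i ≤ N × Shared i)) ⊎ (∀ i → i ≤ N → ¬ Shared i) → Linked b s
    by-shared (inj₁ (i , le , v , p , q)) = refine s k (ℕ.≤-trans (ℕ.≤-reflexive (sym (ℕ.+-suc α k))) bd) a′-inj (fix-vertex c (i * st) (fits le) p q)
      where
      a≢v : ∀ r → a r ≢ v
      a≢v r refl = Ba r (ℕ.≤-trans (ℕ.m≤m+n _ ℓ) (fits le)) p
      a′-inj : Inj (v Vector.∷ a)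
      a′-inj {zero}  {zero}  e = refl
      a′-inj {zero}  {suc y} e = contradiction (sym e) (a≢v y)
      a′-inj {suc x} {zero}  e = contradiction e (a≢v x)
      a′-inj {suc x} {suc y} e = cong suc (a-inj e)
    by-shared (inj₂ none) = by-blocks disj
      where
      disj : Disjoint c′
      -- Distinct thinned separators are at least `ℓ + 1` apart in `c`, so a vertex on both would
      -- also be on separator `i * st + ℓ`.
      disj {i} {j} {v} lt le p q = none i i≤N (v , p , B-interval (ℕ.m≤m+n (i * st) ℓ) mid (ℕ.≤-trans (ℕ.*-monoˡ-≤ st le) (ℕ.*-monoˡ-≤ st (ℕ.n≤1+n N))) p q)
        where
        i≤N = ℕ.≤-trans (ℕ.<⇒≤ lt) le
        mid : i * st + ℓ ≤ j * st
        mid = ℕ.≤-trans (ℕ.≤-trans (ℕ.+-monoʳ-≤ (i * st) (ℕ.n≤1+n ℓ)) (ℕ.≤-reflexive (ℕ.+-comm (i * st) st))) (ℕ.*-monoˡ-≤ st lt)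

-- Pigeonhole and minor models

does⇒ : ∀ {P : Set} (d : Dec P) → does d ≡ true → P
does⇒ (yes p) _ = p

-- Increasing rather than merely injective, because the path of `IP` follows the order of the
-- separators.
Selection : ℕ → ℕ → (ℕ → ℕ) → Set
Selection R N f = (∀ {i j} → i < j → j < R → f i < f j) × (∀ {i} → i < R → f i < N)

private
  cons : (ℕ → ℕ) → ℕ → ℕ
  cons f zero    = zero
  cons f (suc i) = suc (f i)

  cons-selection : ∀ {R N f} → Selection R N f → Selection (suc R) (suc N) (cons f)
  cons-selection {R} {N} {f} (mono , bd) = mono′ , bd′
    where
    mono′ : ∀ {i j} → i < j → j < suc R → cons f i < cons f j
    mono′ {zero}  {suc j} _ _ = s≤s z≤n
    mono′ {suc i} {suc j} (s≤s lt) (s≤s lt′) = s≤s (mono lt lt′)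
    bd′ : ∀ {i} → i < suc R → cons f i < suc N
    bd′ {zero}  _ = s≤s z≤n
    bd′ {suc i} (s≤s lt) = s≤s (bd lt)

  suc-selection : ∀ {R N f} → Selection R N f → Selection R (suc N) (suc ∘ f)
  suc-selection (mono , bd) = (λ lt lt′ → s≤s (mono lt lt′)) , λ lt → s≤s (bd lt)

select-bool : ∀ R₁ R₀ (p : ℕ → Bool) →
  (∃[ f ] (Selection R₁ (R₁ + R₀) f × (∀ {i} → i < R₁ → p (f i) ≡ true))) ⊎
  (∃[ f ] (Selection R₀ (R₁ + R₀) f × (∀ {i} → i < R₀ → p (f i) ≡ false)))
select-bool zero R₀ p = inj₁ (id , ((λ _ ()) , λ ()) , λ ())
select-bool (suc R₁) zero p = inj₂ (id , ((λ _ ()) , λ ()) , λ ())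
select-bool (suc R₁) (suc R₀) p with p zero in eq
... | true with select-bool R₁ (suc R₀) (p ∘ suc)
...   | inj₁ (f , sel , h) = inj₁ (cons f , cons-selection sel , λ { {zero} _ → eq ; {suc i} (s≤s lt) → h lt })
...   | inj₂ (f , sel , h) = inj₂ (suc ∘ f , suc-selection sel , h)
select-bool (suc R₁) (suc R₀) p | false with select-bool (suc R₁) R₀ (p ∘ suc)
...   | inj₁ (f , sel , h) = inj₁ (suc ∘ f , subst (λ N → Selection (suc R₁) (suc N) (suc ∘ f)) (sym (ℕ.+-suc R₁ R₀)) (suc-selection sel) , h)
...   | inj₂ (f , sel , h) = inj₂ (cons f , subst (λ N → Selection (suc R₀) (suc N) (cons f)) (sym (ℕ.+-suc R₁ R₀)) (cons-selection sel) ,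
                                λ { {zero} _ → eq ; {suc i} (s≤s lt) → h lt })

-- Each of the `c` predicates costs a factor 2: keep a half on which it is constant.
select-constant : ∀ c (p : Fin c → ℕ → Bool) R →
  ∃[ f ] (Selection R (R * 2 ^ c) f × (∀ q {i j} → i < R → j < R → p q (f i) ≡ p q (f j)))
select-constant zero p R = id , ((λ lt _ → lt) , λ lt → ℕ.≤-trans lt (ℕ.≤-reflexive (sym (ℕ.*-identityʳ R)))) , λ ()
select-constant (suc c) p R = compose (halve (select-bool M M (p zero)))
  where
  M = R * 2 ^ c
  N≡ : M + M ≡ R * 2 ^ suc c
  N≡ = trans (sym (ℕ.*-distribˡ-+ R (2 ^ c) (2 ^ c))) (cong (λ x → R * (2 ^ c + x)) (sym (ℕ.+-identityʳ (2 ^ c))))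
  Half = ∃[ f ] (Selection M (R * 2 ^ suc c) f × (∀ {i j} → i < M → j < M → p zero (f i) ≡ p zero (f j)))
  halve : _ ⊎ _ → Half
  halve (inj₁ (f , sel , h)) = f , subst (λ N → Selection M N f) N≡ sel , λ x y → trans (h x) (sym (h y))
  halve (inj₂ (f , sel , h)) = f , subst (λ N → Selection M N f) N≡ sel , λ x y → trans (h x) (sym (h y))
  compose : Half → ∃[ f ] (Selection R (R * 2 ^ suc c) f × (∀ q {i j} → i < R → j < R → p q (f i) ≡ p q (f j)))
  compose (g , (g-mono , g-bd) , g-const) with select-constant c (λ q → p (suc q) ∘ g) R
  ... | f , (f-mono , f-bd) , f-const = g ∘ f , ((λ lt lt′ → g-mono (f-mono lt lt′) (f-bd lt′)) , g-bd ∘ f-bd) ,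
    λ { zero x y → g-const (f-bd x) (f-bd y) ; (suc q) x y → f-const q x y }

splitAt-injective : ∀ t {m} {x y : Fin (t + m)} → splitAt t x ≡ splitAt t y → x ≡ y
splitAt-injective t {m} {x} {y} e = trans (sym (Fin.join-splitAt t m x)) (trans (cong (join t m) e) (Fin.join-splitAt t m y))

<ᵇ-left : ∀ {t m} (x : Fin (t + m)) {i} → splitAt t x ≡ inj₁ i → (toℕ x <ᵇ t) ≡ true
<ᵇ-left {t} {m} x {i} e with refl ← Fin.splitAt⁻¹-↑ˡ {t} e rewrite Fin.toℕ-↑ˡ i m = T⇒≡ (ℕ.<⇒<ᵇ (Fin.toℕ<n i))
  where
  T⇒≡ : ∀ {b} → So b → b ≡ true
  T⇒≡ {true} _ = refl

right-toℕ : ∀ {t m} (x : Fin (t + m)) {j} → splitAt t x ≡ inj₂ j → toℕ x ≡ t + toℕ j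
right-toℕ {t} x {j} e with refl ← Fin.splitAt⁻¹-↑ʳ {t} e = Fin.toℕ-↑ʳ t j

<ᵇ-right : ∀ {t m} (x : Fin (t + m)) {j} → splitAt t x ≡ inj₂ j → (toℕ x <ᵇ t) ≡ false
<ᵇ-right {t} x {j} e rewrite right-toℕ x e = +≮ᵇ t
  where
  +≮ᵇ : ∀ a → (a + toℕ j <ᵇ a) ≡ false
  +≮ᵇ zero    = refl
  +≮ᵇ (suc a) = +≮ᵇ a

module Minors (G : Graph) (F : Fin (Graph.n G) → Fin (Graph.n G) → Bool) (F⊆ : ∀ {u v} → F u v ≡ true → adj G u v ≡ true)
              (F-sym : ∀ {u v} → F u v ≡ true → F v u ≡ true) where

  private
    n = Graph.n G

    E : Rel n
    E u v = F u v ≡ true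

  walk⇒reach : ∀ {P u v} → Walk E P u v → Reach G P u v
  walk⇒reach (stop p)   = here p
  walk⇒reach (go p e ω) = step p (F⊆ e) (walk⇒reach ω)

  Touch : FSet n → FSet n → Set
  Touch X Y = ∃[ u ] ∃[ v ] (u ∈ X × v ∈ Y × E u v)

  -- The common part of K_{t,m} and I_t + P_m: all t sets A i touch all m sets W j.
  record Model (t m : ℕ) : Set where
    field
      A       : Fin t → FSet n
      W       : Fin m → FSet n
      A-ne    : ∀ i → ∃[ v ] v ∈ A i
      W-ne    : ∀ j → ∃[ v ] v ∈ W j
      A-disj  : ∀ {i j v} → v ∈ A i → v ∈ A j → i ≡ j
      W-disj  : ∀ {i j v} → v ∈ W i → v ∈ W j → i ≡ j
      AW-disj : ∀ {i j v} → v ∈ A i → v ∉ W j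
      A-conn  : ∀ i → Connected E (A i)
      W-conn  : ∀ j → Connected E (W j)
      touch   : ∀ i j → Touch (A i) (W j)

  module _ {t m} (M : Model t m) where
    open Model M

    private
      branch : Fin t ⊎ Fin m → FSet n
      branch = [ A , W ]′

      branch-disj : ∀ x y {v} → v ∈ branch x → v ∈ branch y → x ≡ y
      branch-disj (inj₁ i) (inj₁ j) p q = cong inj₁ (A-disj p q)
      branch-disj (inj₁ i) (inj₂ j) p q = contradiction q (AW-disj p)
      branch-disj (inj₂ i) (inj₁ j) p q = contradiction p (AW-disj q)
      branch-disj (inj₂ i) (inj₂ j) p q = cong inj₂ (W-disj p q)

      model-minor : ∀ r → (∀ x y → adj (mkGraph (t + m) r) x y ≡ true → Touch (branch (splitAt t x)) (branch (splitAt t y))) →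
        Minor (mkGraph (t + m) r) G
      model-minor r edges = record
        { branch = branch ∘ splitAt t
        ; nonempty = λ x → ne (splitAt t x)
        ; disjoint = λ x y v x≢y p q → x≢y (splitAt-injective t (branch-disj (splitAt t x) (splitAt t y) p q))
        ; connected = λ x u v p q → walk⇒reach (conn (splitAt t x) p q)
        ; edges = λ x y e → let u , v , p , q , e′ = edges x y e in u , v , p , q , F⊆ e′ }
        where
        ne : ∀ x → ∃[ v ] v ∈ branch x
        ne (inj₁ i) = A-ne i
        ne (inj₂ j) = W-ne j
        conn : ∀ x → Connected E (branch x)
        conn (inj₁ i) = A-conn i
        conn (inj₂ j) = W-conn j

      Touch-sym : ∀ {X Y} → Touch X Y → Touch Y X
      Touch-sym (u , v , p , q , e) = v , u , q , p , F-sym e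

    K-minor : Minor (K t m) G
    K-minor = model-minor _ edges
      where
      edges : ∀ x y → adj (K t m) x y ≡ true → Touch (branch (splitAt t x)) (branch (splitAt t y))
      edges x y e with splitAt t x in ex | splitAt t y in ey
      ... | inj₁ i | inj₂ j = touch i j
      ... | inj₂ j | inj₁ i = Touch-sym (touch i j)
      ... | inj₁ i | inj₁ j rewrite <ᵇ-left x ex | <ᵇ-left y ey = case e of λ ()
      ... | inj₂ i | inj₂ j rewrite <ᵇ-right x ex | <ᵇ-right y ey = case e of λ ()

    IP-minor : (∀ i j → toℕ j ≡ suc (toℕ i) → Touch (W i) (W j)) → Minor (IP t m) G
    IP-minor consecutive = model-minor _ edges
      where
      ≡ᵇ⇒≡′ : ∀ a b → (t + b ≡ᵇ suc (t + a)) ≡ true → b ≡ suc a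
      ≡ᵇ⇒≡′ a b e = ℕ.+-cancelˡ-≡ t b (suc a) (trans (ℕ.≡ᵇ⇒≡ (t + b) (suc (t + a)) (subst So (sym e) _)) (sym (ℕ.+-suc t a)))
      edges : ∀ x y → adj (IP t m) x y ≡ true → Touch (branch (splitAt t x)) (branch (splitAt t y))
      edges x y e with splitAt t x in ex | splitAt t y in ey
      ... | inj₁ i | inj₂ j = touch i j
      ... | inj₂ j | inj₁ i = Touch-sym (touch i j)
      ... | inj₁ i | inj₁ j rewrite <ᵇ-left x ex | <ᵇ-left y ey = case e of λ ()
      ... | inj₂ i | inj₂ j rewrite <ᵇ-right x ex | <ᵇ-right y ey | right-toℕ x ex | right-toℕ y ey
        with (t + toℕ j ≡ᵇ suc (t + toℕ i)) in e₁ | (t + toℕ i ≡ᵇ suc (t + toℕ j)) in e₂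
      ... | true  | _     = consecutive i j (≡ᵇ⇒≡′ (toℕ i) (toℕ j) e₁)
      ... | false | true  = Touch-sym (consecutive j i (≡ᵇ⇒≡′ (toℕ j) (toℕ i) e₂))
      ... | false | false = case e of λ ()

  singleton-connected : ∀ x → Connected E ⁅ x ⁆
  singleton-connected x {u} {v} p q = subst₂ (Walk E ⁅ x ⁆) (sym (⁅⁆⁻ p)) (sym (⁅⁆⁻ q)) (stop (⁅⁆⁺ x))

  Neighbour : FSet n → Fin n → Set
  Neighbour X v = ∃[ w ] (w ∈ X × E w v)

  neighbour? : ∀ X v → Dec (Neighbour X v)
  neighbour? X v = Fin.any? (λ w → (w ∈? X) ×-dec (F w v 𝔹.≟ true))

  -- Sort the vertices by the set of all `A x` that they see. Among `m * 2 ^ c` of them, `m` see the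
  -- same sets, and the `t` labels of the first one serve for all.
  common-neighbours⇒K : ∀ {t m c} → 0 < m → (A : Fin c → FSet n) → (∀ i → ∃[ v ] v ∈ A i) →
    (∀ {i j v} → v ∈ A i → v ∈ A j → i ≡ j) → (∀ i → Connected E (A i)) →
    (v : ℕ → Fin n) → let N = m * 2 ^ c in (∀ {i j} → i < j → j < N → v i ≢ v j) →
    (∀ {r} x → r < N → v r ∉ A x) →
    (∀ {r} → r < N → Σ (Fin t → Fin c) λ λ′ → Inj λ′ × (∀ i → Neighbour (A (λ′ i)) (v r))) →
    Minor (K t m) G
  common-neighbours⇒K {t} {m} {c} 0<m A ne disj conn v v-distinct off nbrs
    with select-constant c (λ x r → does (neighbour? (A x) (v r))) m
  ... | f , (f-mono , f-bd) , const with nbrs (f-bd 0<m)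
  ...   | lab , lab-inj , near = K-minor record
    { A = A ∘ lab ; W = λ j → ⁅ v (f (toℕ j)) ⁆
    ; A-ne = ne ∘ lab ; W-ne = λ j → v (f (toℕ j)) , ⁅⁆⁺ (v (f (toℕ j)))
    ; A-disj = λ p q → lab-inj (disj p q)
    ; W-disj = λ {i} {j} {u} → W-disj {i} {j} {u}
    ; AW-disj = λ {i} {j} {u} p q → off (lab i) (f-bd (Fin.toℕ<n j)) (subst (_∈ A (lab i)) (⁅⁆⁻ {v = u} q) p)
    ; A-conn = conn ∘ lab ; W-conn = λ j → singleton-connected _
    ; touch = λ i j → let w , p , e = does⇒ (neighbour? (A (lab i)) (v (f (toℕ j)))) (trans (const (lab i) (Fin.toℕ<n j) 0<m) (dec-true (neighbour? _ _) (near i))) in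
        w , v (f (toℕ j)) , p , ⁅⁆⁺ (v (f (toℕ j))) , e }
    where
    W-disj : ∀ {i j : Fin m} {u} → u ∈ ⁅ v (f (toℕ i)) ⁆ → u ∈ ⁅ v (f (toℕ j)) ⁆ → i ≡ j
    W-disj {i} {j} {u} p q with ℕ.<-cmp (toℕ i) (toℕ j) | trans (sym (⁅⁆⁻ {v = u} p)) (⁅⁆⁻ q)
    ... | tri< lt _ _ | e = contradiction e (v-distinct (f-mono lt (Fin.toℕ<n j)) (f-bd (Fin.toℕ<n j)))
    ... | tri≈ _ eq _ | _ = Fin.toℕ-injective eq
    ... | tri> _ _ gt | e = contradiction (sym e) (v-distinct (f-mono gt (Fin.toℕ<n i)) (f-bd (Fin.toℕ<n i)))

-- From linked chains to minors

-- `Q` is the part of the walk before its first arrival at `y`. Such prefixes make consecutive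
-- pieces of a strand adjacent yet disjoint.
walk-prefix : ∀ {n} {E : Rel n} {P x y} → (∀ {u v} → E u v → E v u) → Walk E P x y → x ≢ y →
  ∃[ Q ] ((∀ {u} → u ∈ Q → u ∈ P) × y ∉ Q × x ∈ Q × (∀ {u} → u ∈ Q → Walk E Q u x) × ∃[ u ] (u ∈ Q × E u y))
walk-prefix s (stop p) x≢y = contradiction refl x≢y
walk-prefix {E = E} {P} {x} {y} s (go {w = w} p e ω) x≢y with w Fin.≟ y
... | yes refl = ⁅ x ⁆ , (λ q → subst (_∈ P) (sym (⁅⁆⁻ q)) p) , (λ q → x≢y (sym (⁅⁆⁻ {x = x} q))) , ⁅⁆⁺ x ,
  (λ q → subst (λ z → Walk E ⁅ x ⁆ z x) (sym (⁅⁆⁻ q)) (stop (⁅⁆⁺ x))) , x , ⁅⁆⁺ x , e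
... | no w≢y with walk-prefix s ω w≢y
... | Q , Q⊆P , y∉Q , w∈Q , toW , u , u∈Q , e′ = ⁅ x ⁆ ∪ Q ,
  (λ q → [ (λ r → subst (_∈ P) (sym (⁅⁆⁻ r)) p) , Q⊆P ]′ (∪⁻ ⁅ x ⁆ Q q)) ,
  (λ q → [ (λ r → x≢y (sym (⁅⁆⁻ {x = x} r))) , y∉Q ]′ (∪⁻ ⁅ x ⁆ Q q)) ,
  x∈ , toX , u , ∪⁺ʳ ⁅ x ⁆ Q u∈Q , e′
  where
  x∈ = ∪⁺ˡ ⁅ x ⁆ Q (⁅⁆⁺ x)
  toX : ∀ {u} → u ∈ ⁅ x ⁆ ∪ Q → Walk E (⁅ x ⁆ ∪ Q) u x
  toX q with ∪⁻ ⁅ x ⁆ Q q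
  ... | inj₁ r = subst (λ z → Walk E (⁅ x ⁆ ∪ Q) z x) (sym (⁅⁆⁻ r)) (stop x∈)
  ... | inj₂ r = walk-++ (walk-map id (∪⁺ʳ ⁅ x ⁆ Q) (toW r)) (go (∪⁺ʳ ⁅ x ⁆ Q w∈Q) (s e) (stop x∈))

-- The reason why `IP` has one apex fewer than `K` has vertices on its left side: a vertex on a
-- strand may see that very strand, and then only `t` of its `suc t` labels can become apices.
drop-label : ∀ {t c} (f : Fin (suc t) → Fin c) → Inj f → ∀ x →
  Σ (Fin t → Fin (suc t)) λ g → Inj g × (∀ i → f (g i) ≢ x)
drop-label f inj x with Fin.any? (λ i → f i Fin.≟ x)
... | yes (i , e) = punchIn i , (λ {a} {b} → Fin.punchIn-injective i a b) , λ j e′ → Fin.punchInᵢ≢i i j (inj (trans e′ (sym e)))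
... | no none = suc , Fin.suc-injective , λ i e → none (suc i , e)

-- Two rounds of pigeonhole over at most `b` strands: which strands contain the vertex, and which
-- ones it sees. The extra one in `suc m` is for the last piece of the path, which extends to the
-- start of a further window.
windows : ℕ → ℕ → ℕ
windows m b = suc m * 2 ^ b * 2 ^ b

module Final (G : Graph) (F : Fin (Graph.n G) → Fin (Graph.n G) → Bool) (F⊆ : ∀ {u v} → F u v ≡ true → adj G u v ≡ true)
             (F-sym : ∀ {u v} → F u v ≡ true → F v u ≡ true) (top : FSet (Graph.n G)) (t : ℕ)
             (noIsland : ∀ X → X ⊆ top → (∃[ v ] v ∈ X) → ∃[ v ] (v ∈ X × suc t ≤ ∣ F v ∖ X ∣)) where

  open Minors G F F⊆ F-sym
  open Chains F F-sym top

  module _ {b s} (Λ : Linked b s) where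
    open Linked Λ

    private
      n = Graph.n G

    U⊆D : ∀ {i j v} → i < j → j ≤ s → v ∈ D j ⊎ v ∈ B j → v ∈ D i
    U⊆D lt le (inj₁ d) = D⊆ (ℕ.<⇒≤ lt) le d
    U⊆D lt le (inj₂ p) with B⊆ (ℕ.<⇒≤ lt) le p
    ... | inj₁ d = d
    ... | inj₂ q = contradiction p (disjoint lt le q)

    U⊆U : ∀ {i j v} → i ≤ j → j ≤ s → v ∈ D j ⊎ v ∈ B j → v ∈ D i ⊎ v ∈ B i
    U⊆U le le′ (inj₁ d) = inj₁ (D⊆ le le′ d)
    U⊆U le le′ (inj₂ p) = B⊆ le le′ p

    c : ℕ
    c = α + k

    strand : Fin α ⊎ Fin k → FSet n
    strand = [ ⁅_⁆ ∘ a , P ]′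

    strands : Fin c → FSet n
    strands = strand ∘ splitAt α

    strand-disj : ∀ x y {v} → v ∈ strand x → v ∈ strand y → x ≡ y
    strand-disj (inj₁ i) (inj₁ j) {v} p q = cong inj₁ (a-inj (trans (sym (⁅⁆⁻ {v = v} p)) (⁅⁆⁻ q)))
    strand-disj (inj₁ i) (inj₂ j) {v} p q = contradiction (sym (⁅⁆⁻ {v = v} p)) (P-a q i)
    strand-disj (inj₂ i) (inj₁ j) {v} p q = contradiction (sym (⁅⁆⁻ {v = v} q)) (P-a p j)
    strand-disj (inj₂ i) (inj₂ j) p q = cong inj₂ (P-disj p q)

    strands-disj : ∀ {x y v} → v ∈ strands x → v ∈ strands y → x ≡ y
    strands-disj {x} {y} p q = splitAt-injective α (strand-disj (splitAt α x) (splitAt α y) p q)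

    strand-ne : ∀ x → ∃[ v ] v ∈ strand x
    strand-ne (inj₁ i) = a i , ⁅⁆⁺ (a i)
    strand-ne (inj₂ q) = let x , p , _ = hit q z≤n in x , p

    strand-conn : ∀ x → Connected E (strand x)
    strand-conn (inj₁ i) = singleton-connected (a i)
    strand-conn (inj₂ q) = P-conn q

    Window : ℕ → ℕ → Fin n → Set
    Window i j v = v ∈ D i × v ∉ D j × v ∉ B j ×
      Σ (Fin (suc t) → Fin c) λ lab → Inj lab × (∀ r → Neighbour (strands (lab r)) v)

    strandAt : ∀ {l w} → l ≤ s → (∃[ q ] a q ≡ w) ⊎ w ∈ B l → ∃[ x ] w ∈ strands x
    strandAt {w = w} l≤ (inj₁ (q , e)) = q ↑ˡ k , subst (λ z → w ∈ strand z) (sym (Fin.splitAt-↑ˡ α q k)) (subst (_∈ ⁅ a q ⁆) e (⁅⁆⁺ (a q)))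
    strandAt {w = w} l≤ (inj₂ p) = let q , r = cover l≤ p in α ↑ʳ q , subst (λ z → w ∈ strand z) (sym (Fin.splitAt-↑ʳ α k q)) r

    -- Common vertices are strands by themselves, and the others meet `B l` once. Hence distinct
    -- neighbours on one separator get distinct labels.
    strand-unique : ∀ {l} x {w w′} → l ≤ s → (∃[ q ] a q ≡ w) ⊎ w ∈ B l → (∃[ q ] a q ≡ w′) ⊎ w′ ∈ B l →
      w ∈ strand x → w′ ∈ strand x → w ≡ w′
    strand-unique (inj₁ i) {w} {w′} l≤ _ _ p q = trans (⁅⁆⁻ p) (sym (⁅⁆⁻ {v = w′} q))
    strand-unique (inj₂ i) l≤ (inj₁ (q , e)) _ p _ = contradiction e (P-a p q)
    strand-unique (inj₂ i) l≤ _ (inj₁ (q , e)) _ p = contradiction e (P-a p q)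
    strand-unique (inj₂ i) l≤ (inj₂ x) (inj₂ y) p q = unique l≤ p q x y

    -- The open region between the two separators is no island. Separators `i + 1` and `i + 2` serve
    -- as buffers: a vertex below `i + 1` has no neighbour in `B i`, and a neighbour in `B j` would
    -- put the vertex on or below `i + 2`, hence below `i + 1`. So all its outside neighbours lie on
    -- one separator.
    window : ∀ i → i + 3 ≤ s → ∃ (Window i (i + 3))
    window i le = fromIsland (noIsland X X⊆top (let v , p , q , r = gap i<j le in v , X⁺ p q r))
      where
      j = i + 3
      i<j : i < j
      i<j = ℕ.≤-trans (ℕ.≤-reflexive (ℕ.+-comm 1 i)) (ℕ.+-monoʳ-≤ i (s≤s z≤n))
      i+1<j : i + 1 < j
      i+1<j = ℕ.≤-trans (ℕ.≤-reflexive (sym (ℕ.+-suc i 1))) (ℕ.+-monoʳ-≤ i (s≤s (s≤s z≤n)))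
      i+2<j : i + 2 < j
      i+2<j = ℕ.≤-reflexive (sym (ℕ.+-suc i 2))
      i+1<i+2 : i + 1 < i + 2
      i+1<i+2 = ℕ.≤-reflexive (sym (ℕ.+-suc i 1))
      i<i+1 : i < i + 1
      i<i+1 = ℕ.≤-reflexive (ℕ.+-comm 1 i)
      i≤s = ℕ.≤-trans (ℕ.<⇒≤ i<j) le
      i+1≤s = ℕ.≤-trans (ℕ.<⇒≤ i+1<j) le
      i+2≤s = ℕ.≤-trans (ℕ.<⇒≤ i+2<j) le
      X : FSet n
      X = D i ∖ (D j ∪ B j)
      X⁺ : ∀ {v} → v ∈ D i → v ∉ D j → v ∉ B j → v ∈ X
      X⁺ p q r = ∖⁺ (D i) (D j ∪ B j) p ([ q , r ]′ ∘ ∪⁻ (D j) (B j))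
      X⊆top : X ⊆ top
      X⊆top p = inTop (D⊆ z≤n i≤s (proj₁ (∖⁻ (D i) (D j ∪ B j) p)))
      module _ {v} (v∈D : v ∈ D i) (v∉D : v ∉ D j) (v∉B : v ∉ B j) where
        outer : ∀ {w} → w ∈ F v ∖ X → (∃[ q ] a q ≡ w) ⊎ w ∈ B i ⊎ w ∈ B j
        outer {w} p with ∖⁻ (F v) X p
        ... | e , w∉X with closed i≤s v∈D e
        ...   | inj₂ (inj₂ x) = inj₁ x
        ...   | inj₂ (inj₁ x) = inj₂ (inj₁ x)
        ...   | inj₁ w∈D with w ∈? B j | w ∈? D j
        ...     | yes x | _ = inj₂ (inj₂ x)
        ...     | no ¬x | no ¬y = contradiction (X⁺ w∈D ¬y ¬x) w∉X
        ...     | no ¬x | yes y with closed le y (F-sym e)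
        ...       | inj₁ z = contradiction z v∉D
        ...       | inj₂ (inj₁ z) = contradiction z v∉B
        ...       | inj₂ (inj₂ (q , refl)) = contradiction v∈D (Da q i≤s)
        -- The separators are far enough apart that v cannot see both B i and B j.
        side : ∃[ l ] (l ≤ s × (∀ {w} → w ∈ F v ∖ X → (∃[ q ] a q ≡ w) ⊎ w ∈ B l))
        side with v ∈? D (i + 1)
        ... | yes d = j , le , λ p → sideʳ p (outer p)
          where
          sideʳ : ∀ {w} → w ∈ F v ∖ X → (∃[ q ] a q ≡ w) ⊎ w ∈ B i ⊎ w ∈ B j → (∃[ q ] a q ≡ w) ⊎ w ∈ B j
          sideʳ p (inj₁ x) = inj₁ x
          sideʳ p (inj₂ (inj₂ x)) = inj₂ x
          sideʳ p (inj₂ (inj₁ x)) with closed i+1≤s d (proj₁ (∖⁻ (F v) X p))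
          ... | inj₁ y = contradiction x (DB i≤s (D⊆ (ℕ.<⇒≤ i<i+1) i+1≤s y))
          ... | inj₂ (inj₁ y) = contradiction y (disjoint i<i+1 i+1≤s x)
          ... | inj₂ (inj₂ y) = inj₁ y
        ... | no ¬d = i , i≤s , λ p → sideˡ p (outer p)
          where
          sideˡ : ∀ {w} → w ∈ F v ∖ X → (∃[ q ] a q ≡ w) ⊎ w ∈ B i ⊎ w ∈ B j → (∃[ q ] a q ≡ w) ⊎ w ∈ B i
          sideˡ p (inj₁ x) = inj₁ x
          sideˡ p (inj₂ (inj₁ x)) = inj₂ x
          sideˡ p (inj₂ (inj₂ x)) with closed i+2≤s (U⊆D i+2<j le (inj₂ x)) (F-sym (proj₁ (∖⁻ (F v) X p)))
          ... | inj₁ y = contradiction (U⊆D i+1<i+2 i+2≤s (inj₁ y)) ¬d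
          ... | inj₂ (inj₁ y) = contradiction (U⊆D i+1<i+2 i+2≤s (inj₂ y)) ¬d
          ... | inj₂ (inj₂ (q , refl)) = contradiction v∈D (Da q i≤s)
      fromIsland : ∃[ v ] (v ∈ X × suc t ≤ ∣ F v ∖ X ∣) → ∃ (Window i j)
      fromIsland (v , v∈X , many) with ∖⁻ (D i) (D j ∪ B j) v∈X
      ... | v∈D , v∉U with side v∈D (v∉U ∘ ∪⁺ˡ (D j) (B j)) (v∉U ∘ ∪⁺ʳ (D j) (B j)) | choose (F v ∖ X) many
      ...   | l , l≤ , on | w , w-inj , w∈ = v , v∈D , (v∉U ∘ ∪⁺ˡ (D j) (B j)) , (v∉U ∘ ∪⁺ʳ (D j) (B j)) ,
        lab , lab-inj , λ r → w r , proj₂ (at r) , F-sym (proj₁ (∖⁻ (F v) X (w∈ r)))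
        where
        at : ∀ r → ∃[ x ] w r ∈ strands x
        at r = strandAt l≤ (on (w∈ r))
        lab : Fin (suc t) → Fin c
        lab r = proj₁ (at r)
        lab-inj : Inj lab
        lab-inj {r} {r′} e = w-inj (strand-unique (splitAt α (lab r)) l≤ (on (w∈ r)) (on (w∈ r′)) (proj₂ (at r))
          (subst (λ x → w r′ ∈ strands x) (sym e) (proj₂ (at r′))))

    module Segments (q : Fin k) where

      x : ∀ l → l ≤ s → Fin n
      x l le = proj₁ (hit q le)

      x∈P : ∀ {l} (le : l ≤ s) → x l le ∈ P q
      x∈P le = proj₁ (proj₂ (hit q le))

      x∈B : ∀ {l} (le : l ≤ s) → x l le ∈ B l
      x∈B le = proj₂ (proj₂ (hit q le))

      ray : ℕ → FSet n
      ray l = P q ∩ (D l ∪ B l)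

      segment : ℕ → ℕ → FSet n
      segment i j = ray i ∩ ∁ (D j)

      segment⁺ : ∀ {i j v} → v ∈ P q → v ∈ D i ⊎ v ∈ B i → v ∉ D j → v ∈ segment i j
      segment⁺ {i} {j} p u d = ∩⁺ (ray i) (∁ (D j)) (∩⁺ (P q) (D i ∪ B i) p ([ ∪⁺ˡ (D i) (B i) , ∪⁺ʳ (D i) (B i) ]′ u)) (∁⁺ (D j) d)

      segment⁻ : ∀ {i j v} → v ∈ segment i j → v ∈ P q × (v ∈ D i ⊎ v ∈ B i) × v ∉ D j
      segment⁻ {i} {j} p = let r , d = ∩⁻ (ray i) (∁ (D j)) p ; p′ , u = ∩⁻ (P q) (D i ∪ B i) r in p′ , ∪⁻ (D i) (B i) u , ∁⁻ (D j) d

      left∈ : ∀ {i j} (i≤ : i ≤ s) (j≤ : j ≤ s) → i ≤ j → x i i≤ ∈ segment i j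
      left∈ i≤ j≤ le = segment⁺ (x∈P i≤) (inj₂ (x∈B i≤)) λ d → DB i≤ (D⊆ le j≤ d) (x∈B i≤)

      right∈ : ∀ {i j} (j≤ : j ≤ s) → i ≤ j → x j j≤ ∈ segment i j
      right∈ j≤ le = segment⁺ (x∈P j≤) (B⊆ le j≤ (x∈B j≤)) λ d → DB j≤ d (x∈B j≤)

      -- The strand meets `B i` and `B j` once each, so these two vertices are its only passages out
      -- of the segment, and it can be clipped there.
      segment-connected : ∀ {i j} → i ≤ j → j ≤ s → Connected E (segment i j)
      segment-connected {i} {j} le j≤ = connected-clip (ray i) (∁ (D j)) (x j j≤) F-sym
        (connected-clip (P q) (D i ∪ B i) (x i i≤) F-sym (P-conn q) (x∈P i≤) stayˡ)
        (proj₁ (∩⁻ (ray i) (∁ (D j)) (right∈ j≤ le))) stayʳ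
        where
        i≤ = ℕ.≤-trans le j≤
        stayˡ : ∀ {y z} → y ∈ P q → y ∈ D i ∪ B i → y ≢ x i i≤ → E y z → z ∈ P q → z ∈ D i ∪ B i
        stayˡ p u ne e p′ with ∪⁻ (D i) (B i) u
        ... | inj₂ b′ = contradiction (unique i≤ p (x∈P i≤) b′ (x∈B i≤)) ne
        ... | inj₁ d with closed i≤ d e
        ...   | inj₁ y = ∪⁺ˡ (D i) (B i) y
        ...   | inj₂ (inj₁ y) = ∪⁺ʳ (D i) (B i) y
        ...   | inj₂ (inj₂ (r , y)) = contradiction y (P-a p′ r)
        stayʳ : ∀ {y z} → y ∈ ray i → y ∈ ∁ (D j) → y ≢ x j j≤ → E y z → z ∈ ray i → z ∈ ∁ (D j)
        stayʳ p u ne e p′ = ∁⁺ (D j) λ d → case closed j≤ d (F-sym e) of λ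
          { (inj₁ y) → ∁⁻ (D j) u y
          ; (inj₂ (inj₁ y)) → ne (unique j≤ (proj₁ (∩⁻ (P q) (D i ∪ B i) p)) (x∈P j≤) y (x∈B j≤))
          ; (inj₂ (inj₂ (r , y))) → P-a (proj₁ (∩⁻ (P q) (D i ∪ B i) p)) r y }

      -- A branch set for one path vertex: the strand within a window, prolonged until just before
      -- its vertex on the separator `l` where the next window starts.
      Piece : ∀ i j l → l ≤ s → Set
      Piece i j l l≤ = ∃[ W ] (
        (∀ {v} → v ∈ segment i j → v ∈ W) × (∀ {v} → v ∈ W → v ∈ P q × (v ∈ D i ⊎ v ∈ B i) × v ∉ D l × v ∉ B l) ×
        Connected E W × ∃[ u ] (u ∈ W × E u (x l l≤)))

      piece : ∀ {i j l} → i ≤ j → j < l → (l≤ : l ≤ s) → Piece i j l l≤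
      piece {i} {j} {l} i≤j j<l l≤ with walk-prefix F-sym (segment-connected (ℕ.<⇒≤ j<l) l≤ (left∈ j≤ l≤ (ℕ.<⇒≤ j<l)) (right∈ l≤ (ℕ.<⇒≤ j<l)))
                                      (λ e → disjoint j<l l≤ (x∈B j≤) (subst (_∈ B l) (sym e) (x∈B l≤)))
        where j≤ = ℕ.≤-trans (ℕ.<⇒≤ j<l) l≤
      ... | Q , Q⊆ , y∉Q , x∈Q , toX , u , u∈Q , e = W , ∪⁺ˡ (segment i j) Q , W⊆ , (λ p p′ → walk-++ (toHub p) (walk-reverse F-sym (toHub p′))) , u , ∪⁺ʳ (segment i j) Q u∈Q , e
        where
        j≤ = ℕ.≤-trans (ℕ.<⇒≤ j<l) l≤
        W = segment i j ∪ Q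
        W⊆ : ∀ {v} → v ∈ W → v ∈ P q × (v ∈ D i ⊎ v ∈ B i) × v ∉ D l × v ∉ B l
        W⊆ {v} p with ∪⁻ (segment i j) Q p
        ... | inj₁ r = let a₁ , a₂ , a₃ = segment⁻ {i} {j} r in a₁ , a₂ , (a₃ ∘ U⊆D j<l l≤ ∘ inj₁) , (a₃ ∘ U⊆D j<l l≤ ∘ inj₂)
        ... | inj₂ r = let a₁ , a₂ , a₃ = segment⁻ {j} {l} (Q⊆ r) in a₁ , U⊆U i≤j j≤ a₂ , a₃ ,
          λ b′ → y∉Q (subst (_∈ Q) (unique l≤ a₁ (x∈P l≤) b′ (x∈B l≤)) r)
        toHub : ∀ {v} → v ∈ W → Walk E W v (x j j≤)
        toHub p with ∪⁻ (segment i j) Q p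
        ... | inj₁ r = walk-map id (∪⁺ˡ (segment i j) Q) (segment-connected i≤j j≤ r (right∈ j≤ i≤j))
        ... | inj₂ r = walk-map id (∪⁺ʳ (segment i j) Q) (toX r)

    -- Strand `q` is cut into one piece per window, each containing a vertex that sees all strands
    -- in `lab`. These differ from `q`, hence are disjoint from the pieces and become the apices.
    strands⇒IP : ∀ {m} q (lo hi : ℕ → ℕ) → (∀ i → lo i ≤ hi i) → (∀ {i j} → i < j → j ≤ m → hi i < lo j) → lo m ≤ s →
      (v : ℕ → Fin n) → (∀ {i} → i < m → v i ∈ P q × v i ∈ D (lo i) × v i ∉ D (hi i)) →
      (lab : Fin t → Fin c) → Inj lab → (∀ r → lab r ≢ α ↑ʳ q) → (∀ r {i} → i < m → Neighbour (strands (lab r)) (v i)) →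
      Minor (IP t m) G
    strands⇒IP {m} q lo hi lo≤hi hi<lo lo≤s v v∈ lab lab-inj lab≢q near = IP-minor model consecutive
      where
      open Segments q
      lo-≤ : ∀ {i j} → i ≤ j → j ≤ m → lo i ≤ lo j
      lo-≤ {i} le le′ = case ℕ.m≤n⇒m<n∨m≡n le of λ { (inj₁ lt) → ℕ.≤-trans (lo≤hi i) (ℕ.<⇒≤ (hi<lo lt le′)) ; (inj₂ refl) → ℕ.≤-refl }
      lo≤ : ∀ {i} → i ≤ m → lo i ≤ s
      lo≤ le = ℕ.≤-trans (lo-≤ le ℕ.≤-refl) lo≤s
      abstract
        data-at : (j : Fin m) → Piece (lo (toℕ j)) (hi (toℕ j)) (lo (suc (toℕ j))) (lo≤ (Fin.toℕ<n j))
        data-at j = piece (lo≤hi (toℕ j)) (hi<lo (ℕ.n<1+n (toℕ j)) (Fin.toℕ<n j)) (lo≤ (Fin.toℕ<n j))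
      W : Fin m → FSet n
      W j = proj₁ (data-at j)
      seg⊆W : ∀ j {u} → u ∈ segment (lo (toℕ j)) (hi (toℕ j)) → u ∈ W j
      seg⊆W j = proj₁ (proj₂ (data-at j))
      W⊆ : ∀ j {u} → u ∈ W j → u ∈ P q × (u ∈ D (lo (toℕ j)) ⊎ u ∈ B (lo (toℕ j))) × u ∉ D (lo (suc (toℕ j))) × u ∉ B (lo (suc (toℕ j)))
      W⊆ j = proj₁ (proj₂ (proj₂ (data-at j)))
      v∈W : ∀ j → v (toℕ j) ∈ W j
      v∈W j = let p , d , ¬d = v∈ (Fin.toℕ<n j) in seg⊆W j (segment⁺ p (inj₁ d) ¬d)
      W-lt : ∀ i j {u} → toℕ i < toℕ j → u ∈ W i → u ∉ W j
      W-lt i j lt p p′ with W⊆ i p | W⊆ j p′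
      ... | _ , _ , ¬d , ¬b | _ , u , _ = [ ¬d , ¬b ]′ (U⊆U (lo-≤ lt (ℕ.<⇒≤ (Fin.toℕ<n j))) (lo≤ (ℕ.<⇒≤ (Fin.toℕ<n j))) u)
      model : Model t m
      model = record
        { A = strands ∘ lab ; W = W
        ; A-ne = strand-ne ∘ splitAt α ∘ lab ; W-ne = λ j → _ , v∈W j
        ; A-disj = λ p p′ → lab-inj (strands-disj p p′)
        ; W-disj = W-disj
        ; AW-disj = λ {r} {j} {u} p p′ → lab≢q r (strands-disj p (subst (λ Z → u ∈ strand Z) (sym (Fin.splitAt-↑ʳ α k q)) (proj₁ (W⊆ j p′))))
        ; A-conn = strand-conn ∘ splitAt α ∘ lab ; W-conn = λ j → proj₁ (proj₂ (proj₂ (proj₂ (data-at j))))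
        ; touch = λ r j → let w , p , e = near r (Fin.toℕ<n j) in w , v (toℕ j) , p , v∈W j , e }
        where
        W-disj : ∀ {i j u} → u ∈ W i → u ∈ W j → i ≡ j
        W-disj {i} {j} p p′ with ℕ.<-cmp (toℕ i) (toℕ j)
        ... | tri< lt _ _ = contradiction p′ (W-lt i j lt p)
        ... | tri≈ _ e _  = Fin.toℕ-injective e
        ... | tri> _ _ gt = contradiction p (W-lt j i gt p′)
      consecutive : ∀ i j → toℕ j ≡ suc (toℕ i) → Touch (W i) (W j)
      consecutive i j e with proj₂ (proj₂ (proj₂ (proj₂ (data-at i))))
      ... | u , u∈W , e′ = u , _ , u∈W , seg⊆W j (start (toℕ j) e (Fin.toℕ<n j)) , e′
        where
        start : ∀ j′ → j′ ≡ suc (toℕ i) → j′ < m → x (lo (suc (toℕ i))) (lo≤ (Fin.toℕ<n i)) ∈ segment (lo j′) (hi j′)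
        start _ refl lt = left∈ _ (ℕ.≤-trans (ℕ.<⇒≤ (hi<lo (ℕ.n<1+n _) lt)) (lo≤ lt)) (lo≤hi _)

  linked⇒minor : ∀ {m b} → 0 < m → Linked b (windows m b * 4 + 3) → Minor (K (suc t) m) G ⊎ Minor (IP t m) G
  linked⇒minor {m} {b} 0<m Λ = byCase (Fin.any? λ x → v (f 0) ∈? strands Λ x)
    where
    open Linked Λ
    N = windows m b
    -- Window `r` occupies separators `4r` to `4r + 3`; the stride 4 keeps successive windows
    -- strictly apart.
    s = N * 4 + 3
    fits : ∀ {r} → r ≤ N → r * 4 + 3 ≤ s
    fits le = ℕ.+-monoˡ-≤ 3 (ℕ.*-monoˡ-≤ 4 le)
    windowAt : ∀ r → r ≤ N → ∃ (Window Λ (r * 4) (r * 4 + 3))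
    windowAt r le = window Λ (r * 4) (fits le)
    abstract
      family : Σ (ℕ → V G) λ v → ∀ r → r ≤ N → Window Λ (r * 4) (r * 4 + 3) (v r)
      family = tabulate≤ N (proj₁ (windowAt 0 z≤n)) windowAt
    v : ℕ → V G
    v = proj₁ family
    v-window : ∀ {r} → r ≤ N → Window Λ (r * 4) (r * 4 + 3) (v r)
    v-window {r} = proj₂ family r
    R₁ = suc m * 2 ^ c Λ
    R₁≤N : R₁ * 2 ^ c Λ ≤ N
    R₁≤N = ℕ.*-mono-≤ (ℕ.*-monoʳ-≤ (suc m) 2^c≤) 2^c≤
      where
      2^c≤ : 2 ^ c Λ ≤ 2 ^ b
      2^c≤ = ℕ.^-monoʳ-≤ 2 bound
    abstract
      chosen : ∃[ f ] (Selection R₁ (R₁ * 2 ^ c Λ) f × (∀ x {i j} → i < R₁ → j < R₁ → strands Λ x (v (f i)) ≡ strands Λ x (v (f j))))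
      chosen = select-constant (c Λ) (λ x r → strands Λ x (v r)) R₁
    f = proj₁ chosen
    f-sel = proj₁ (proj₂ chosen)
    f≤ : ∀ {i} → i < R₁ → f i ≤ N
    f≤ lt = ℕ.≤-trans (ℕ.<⇒≤ (proj₂ f-sel lt)) R₁≤N
    0<R₁ : 0 < R₁
    0<R₁ = ℕ.*-mono-≤ {1} {suc m} {1} (s≤s z≤n) (ℕ.^-monoʳ-≤ 2 {0} {c Λ} z≤n)
    lo<hi : ∀ {i j} → i < j → i * 4 + 3 < j * 4
    lo<hi {i} lt = ℕ.≤-trans (ℕ.≤-reflexive (trans (sym (ℕ.+-suc (i * 4) 3)) (ℕ.+-comm (i * 4) 4))) (ℕ.*-monoˡ-≤ 4 lt)
    same : ∀ x {i j} → i < R₁ → j < R₁ → v (f i) ∈ strands Λ x → v (f j) ∈ strands Λ x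
    same x lt lt′ p = trans (proj₂ (proj₂ chosen) x lt′ lt) p
    byCase : Dec (∃[ x ] v (f 0) ∈ strands Λ x) → Minor (K (suc t) m) G ⊎ Minor (IP t m) G
    byCase (no none) = inj₁ (common-neighbours⇒K 0<m (strands Λ) (strand-ne Λ ∘ splitAt α) (strands-disj Λ) (strand-conn Λ ∘ splitAt α) (v ∘ f)
      distinct (λ x lt p → none (x , same x (up lt) 0<R₁ p)) (λ lt → let _ , _ , _ , nbrs = v-window (f≤ (up lt)) in nbrs))
      where
      up : ∀ {r} → r < m * 2 ^ c Λ → r < R₁
      up lt = ℕ.≤-trans lt (ℕ.*-monoˡ-≤ (2 ^ c Λ) (ℕ.n≤1+n m))
      distinct : ∀ {i j} → i < j → j < m * 2 ^ c Λ → v (f i) ≢ v (f j)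
      distinct {i} {j} lt lt′ e =
        let i<R = up (ℕ.<-trans lt lt′) ; j<R = up lt′
            _ , ¬d , _ = v-window (f≤ i<R) ; d , _ = v-window (f≤ j<R)
        in ¬d (subst (_∈ D (f i * 4 + 3)) (sym e) (D⊆ (ℕ.<⇒≤ (lo<hi (proj₁ f-sel lt j<R))) (ℕ.≤-trans (ℕ.m≤m+n _ 3) (fits (f≤ j<R))) d))
    byCase (yes (x , p)) with splitAt α x in ex
    -- A one-vertex strand is a common vertex, and those avoid every `D`.
    ... | inj₁ i = contradiction (subst (_∈ D (f 0 * 4)) (⁅⁆⁻ p) (proj₁ (v-window (f≤ 0<R₁)))) (Da i (ℕ.≤-trans (ℕ.m≤m+n _ 3) (fits (f≤ 0<R₁))))
    ... | inj₂ q with select-constant (c Λ) (λ x r → does (neighbour? (strands Λ x) (v (f r)))) (suc m)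
    ...   | g , g-sel , g-const = inj₂ (strands⇒IP Λ q (λ i → f (g i) * 4) (λ i → f (g i) * 4 + 3) (λ i → ℕ.m≤m+n _ 3)
        (λ lt le → lo<hi (proj₁ f-sel (proj₁ g-sel lt (s≤s le)) (proj₂ g-sel (s≤s le))))
        (ℕ.≤-trans (ℕ.m≤m+n _ 3) (fits (f≤ (proj₂ g-sel ℕ.≤-refl)))) (v ∘ f ∘ g)
        (λ lt → let g<R = proj₂ g-sel (ℕ.m≤n⇒m≤1+n lt) ; d , ¬d , _ = v-window (f≤ g<R) in onStrand g<R , d , ¬d)
        (lab ∘ pick) (pick-inj ∘ lab-inj) (λ r → lab≢x r ∘ λ e → trans e (Fin.splitAt⁻¹-↑ʳ {α} ex))
        λ r {i} lt → does⇒ (neighbour? _ (v (f (g i)))) (trans (g-const (lab (pick r)) {i} {0} (ℕ.m≤n⇒m≤1+n lt) (s≤s z≤n)) (dec-true (neighbour? _ _) (near (pick r)))))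
      where
      w₀ = v-window (f≤ (proj₂ g-sel {0} (s≤s z≤n)))
      lab = proj₁ (proj₂ (proj₂ (proj₂ w₀)))
      lab-inj : Inj lab
      lab-inj = proj₁ (proj₂ (proj₂ (proj₂ (proj₂ w₀))))
      near : ∀ r → Neighbour (strands Λ (lab r)) (v (f (g 0)))
      near = proj₂ (proj₂ (proj₂ (proj₂ (proj₂ w₀))))
      dropped = drop-label lab lab-inj x
      pick = proj₁ dropped
      pick-inj : Inj pick
      pick-inj = proj₁ (proj₂ dropped)
      lab≢x : ∀ r → lab (pick r) ≢ x
      lab≢x = proj₂ (proj₂ dropped)
      onStrand : ∀ {i} → i < R₁ → v (f i) ∈ P q
      onStrand {i} lt = subst (λ y → v (f i) ∈ strand Λ y) ex (same x 0<R₁ lt (subst (λ y → v (f 0) ∈ strand Λ y) (sym ex) p))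

-- Rooting a tree

sumFin-cong : ∀ k {f g : Fin k → ℕ} → (∀ i → f i ≡ g i) → sumFin k f ≡ sumFin k g
sumFin-cong zero    e = refl
sumFin-cong (suc k) e = cong₂ _+_ (e zero) (sumFin-cong k (e ∘ suc))

sumFin-+ : ∀ k (f g : Fin k → ℕ) → sumFin k (λ i → f i + g i) ≡ sumFin k f + sumFin k g
sumFin-+ zero    f g = refl
sumFin-+ (suc k) f g = trans (cong (f zero + g zero +_) (sumFin-+ k (f ∘ suc) (g ∘ suc)))
  (interchange (f zero) (g zero) (sumFin k (f ∘ suc)) (sumFin k (g ∘ suc)))

sumFin-0 : ∀ k → sumFin k (λ _ → 0) ≡ 0
sumFin-0 zero = refl
sumFin-0 (suc k) = sumFin-0 k

sumFin-swap : ∀ k l (f : Fin k → Fin l → ℕ) → sumFin k (λ i → sumFin l (f i)) ≡ sumFin l (λ j → sumFin k (λ i → f i j))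
sumFin-swap zero    l f = sym (sumFin-0 l)
sumFin-swap (suc k) l f = trans (cong (sumFin l (f zero) +_) (sumFin-swap k l (f ∘ suc))) (sym (sumFin-+ l (f zero) _))

sumFin-mono : ∀ k {f g : Fin k → ℕ} → (∀ i → f i ≤ g i) → sumFin k f ≤ sumFin k g
sumFin-mono zero    le = z≤n
sumFin-mono (suc k) le = ℕ.+-mono-≤ (le zero) (sumFin-mono k (le ∘ suc))

≤sumFin : ∀ k (f : Fin k → ℕ) i → f i ≤ sumFin k f
≤sumFin (suc k) f zero    = ℕ.m≤m+n _ _
≤sumFin (suc k) f (suc i) = ℕ.≤-trans (≤sumFin k (f ∘ suc) i) (ℕ.m≤n+m _ (f zero))

sumFin-tight : ∀ k {f g : Fin k → ℕ} → (∀ i → g i ≤ f i) → sumFin k f ≤ sumFin k g → ∀ i → f i ≤ g i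
sumFin-tight (suc k) {f} {g} le tot zero = ℕ.+-cancelʳ-≤ (sumFin k (f ∘ suc)) _ _ (ℕ.≤-trans tot (ℕ.+-monoʳ-≤ (g zero) (sumFin-mono k (le ∘ suc))))
sumFin-tight (suc k) {f} {g} le tot (suc i) = sumFin-tight k (le ∘ suc)
  (ℕ.+-cancelˡ-≤ (f zero) _ _ (ℕ.≤-trans tot (ℕ.+-monoˡ-≤ (sumFin k (g ∘ suc)) (le zero)))) i

indicator : Bool → ℕ
indicator b = if b then 1 else 0

∣∣≡sumFin : ∀ {k} (P : FSet k) → ∣ P ∣ ≡ sumFin k (indicator ∘ P)
∣∣≡sumFin {zero}  P = refl
∣∣≡sumFin {suc k} P = cong (indicator (P zero) +_) (∣∣≡sumFin (P ∘ suc))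

least : ∀ {P : ℕ → Set} → (∀ k → Dec (P k)) → ∀ k → P k → ∃[ d ] (P d × (∀ {j} → j < d → ¬ P j))
least P? zero p = zero , p , λ ()
least P? (suc k) p with P? zero
... | yes p₀ = zero , p₀ , λ ()
... | no ¬p₀ with least (P? ∘ suc) k p
...   | d , pd , min = suc d , pd , λ { {zero} _ → ¬p₀ ; {suc j} (s≤s lt) → min lt }

record Rooted (T : Graph) : Set where
  field
    root      : V T
    depth     : V T → ℕ
    parent    : V T → V T
    par-depth : ∀ {x} → x ≢ root → depth (parent x) < depth x
    tree-edge : ∀ {x y} → adj T x y ≡ true → (y ≢ root × x ≡ parent y) ⊎ (x ≢ root × y ≡ parent x)

-- Every vertex other than the root has a neighbour that is closer to the root. As there are
-- only n - 1 edges, it has exactly one, and no edge joins vertices at the same distance.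
rooted : (T : Graph) → IsTree T → Rooted T
rooted T isTree = record { root = root ; depth = depth ; parent = parent ; par-depth = par-depth ; tree-edge = tree-edge }
  where
  open IsTree isTree
  N = Graph.n T
  root : V T
  root = fromℕ< nonempty
  adjacent : V T → V T → Set
  adjacent u v = adj T u v ≡ true
  ball : ℕ → FSet N
  nextTo? : ∀ k v → Dec (∃[ u ] (u ∈ ball k × adjacent v u))
  ball zero    = ⁅ root ⁆
  ball (suc k) = ball k ∪ λ v → does (nextTo? k v)
  nextTo? k v = Fin.any? (λ u → (u ∈? ball k) ×-dec (adj T v u 𝔹.≟ true))
  reach-ball : ∀ {P u} → Reach T P u root → ∃[ k ] u ∈ ball k
  reach-ball (here _) = 0 , ⁅⁆⁺ root
  reach-ball (step {u = u} _ e ρ) = let k , p = reach-ball ρ in suc k , ∪⁺ʳ (ball k) (λ v → does (nextTo? k v)) (dec-true (nextTo? k u) (_ , p , e))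
  layer : ∀ v → ∃[ d ] (v ∈ ball d × (∀ {j} → j < d → v ∉ ball j))
  layer v = let k , p = reach-ball (connected v root) in least (λ k → v ∈? ball k) k p
  depth : V T → ℕ
  depth v = proj₁ (layer v)
  depth≤ : ∀ {v k} → v ∈ ball k → depth v ≤ k
  depth≤ {v} {k} p = ℕ.≮⇒≥ λ lt → proj₂ (proj₂ (layer v)) lt p
  closer : ∀ v → v ≢ root → ∃[ u ] (adjacent v u × depth u < depth v)
  closer v ne with layer v
  ... | zero , p , _ = contradiction (⁅⁆⁻ p) ne
  ... | suc d , p , min with ∪⁻ (ball d) (λ v → does (nextTo? d v)) p
  ...   | inj₁ q = contradiction q (min ℕ.≤-refl)
  ...   | inj₂ q = let u , q′ , e = does⇒ (nextTo? d v) q in u , e , s≤s (depth≤ q′)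
  depth-root : depth root ≡ 0
  depth-root = ℕ.n≤0⇒n≡0 (depth≤ (⁅⁆⁺ root))
  parent : V T → V T
  parent v with v Fin.≟ root
  ... | yes _ = root
  ... | no ne = proj₁ (closer v ne)
  parent-spec : ∀ {v} → v ≢ root → adjacent v (parent v) × depth (parent v) < depth v
  parent-spec {v} ne with v Fin.≟ root
  ... | yes e = contradiction e ne
  ... | no ne′ = proj₂ (closer v ne′)
  par-depth : ∀ {x} → x ≢ root → depth (parent x) < depth x
  par-depth = proj₂ ∘ parent-spec
  lower level upper : V T → FSet N
  lower v u = adj T v u ∧ does (depth u <? depth v)
  level v u = adj T v u ∧ does (depth u ℕ.≟ depth v)
  upper v u = adj T v u ∧ does (depth v <? depth u)
  trichotomy : ∀ v u → indicator (adj T v u) ≡ indicator (lower v u) + indicator (level v u) + indicator (upper v u)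
  trichotomy v u with adj T v u
  ... | false = refl
  ... | true  = exactly-one (depth u <? depth v) (depth u ℕ.≟ depth v) (depth v <? depth u)
    where
    exactly-one : ∀ {a b} (d₁ : Dec (a < b)) (d₂ : Dec (a ≡ b)) (d₃ : Dec (b < a)) →
      1 ≡ indicator (does d₁) + indicator (does d₂) + indicator (does d₃)
    exactly-one (yes p) (yes q) _       = contradiction q (ℕ.<⇒≢ p)
    exactly-one (yes p) (no _)  (yes r) = contradiction r (ℕ.<-asym p)
    exactly-one (yes _) (no _)  (no _)  = refl
    exactly-one (no _)  (yes q) (yes r) = contradiction (sym q) (ℕ.<⇒≢ r)
    exactly-one (no _)  (yes _) (no _)  = refl
    exactly-one (no _)  (no _)  (yes _) = refl
    exactly-one (no p)  (no q)  (no r)  = contradiction (ℕ.≤-antisym (ℕ.≮⇒≥ r) (ℕ.≮⇒≥ p)) q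
  degree : ∀ v → ∣ adj T v ∣ ≡ ∣ lower v ∣ + ∣ level v ∣ + ∣ upper v ∣
  degree v = trans (∣∣≡sumFin (adj T v)) (trans (sumFin-cong N (trichotomy v)) (trans (sumFin-+ N _ (indicator ∘ upper v))
    (cong₂ _+_ (trans (sumFin-+ N (indicator ∘ lower v) (indicator ∘ level v)) (cong₂ _+_ (sym (∣∣≡sumFin (lower v))) (sym (∣∣≡sumFin (level v)))))
      (sym (∣∣≡sumFin (upper v))))))
  Σlower Σlevel Σupper : ℕ
  Σlower = sumFin N (∣_∣ ∘ lower)
  Σlevel = sumFin N (∣_∣ ∘ level)
  Σupper = sumFin N (∣_∣ ∘ upper)
  Σupper≡Σlower : Σupper ≡ Σlower
  Σupper≡Σlower = trans (sumFin-cong N (∣∣≡sumFin ∘ upper)) (trans (sumFin-swap N N (λ v u → indicator (upper v u)))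
    (trans (sumFin-cong N (λ u → sumFin-cong N (λ v → cong (λ e → indicator (e ∧ does (depth v <? depth u))) (Graph.sym T v u))))
      (sumFin-cong N (sym ∘ ∣∣≡sumFin ∘ lower))))
  total : Σlower + Σlevel + Σlower + 2 ≡ 2 * N
  total = trans (cong (_+ 2) (trans (cong (Σlower + Σlevel +_) (sym Σupper≡Σlower))
    (sym (trans (sumFin-cong N degree) (trans (sumFin-+ N _ (∣_∣ ∘ upper)) (cong (_+ Σupper) (sumFin-+ N (∣_∣ ∘ lower) (∣_∣ ∘ level)))))))) edgeCount
  others : V T → ℕ
  others v = indicator (not (does (v Fin.≟ root)))
  others≤lower : ∀ v → others v ≤ ∣ lower v ∣
  others≤lower v with v Fin.≟ root
  ... | yes _ = z≤n
  ... | no ne = let u , e , lt = closer v ne in ∈⇒0<∣∣ (lower v) {u} (cong₂ _∧_ e (dec-true (depth u <? depth v) lt))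
  Σothers : N ≤ sumFin N others + 1
  Σothers = ℕ.≤-trans (ℕ.≤-reflexive (sym (trans (sumFin-cong N all) (sumFin-1 N))))
    (ℕ.≤-trans (ℕ.≤-reflexive (sumFin-+ N others (indicator ∘ ⁅ root ⁆))) (ℕ.+-monoʳ-≤ _ (ℕ.≤-trans (ℕ.≤-reflexive (sym (∣∣≡sumFin ⁅ root ⁆))) (∣⁅⁆∣≤1 root))))
    where
    all : ∀ v → others v + indicator (⁅ root ⁆ v) ≡ 1
    all v with does (v Fin.≟ root)
    ... | true  = refl
    ... | false = refl
    sumFin-1 : ∀ k → sumFin k (λ _ → 1) ≡ k
    sumFin-1 zero = refl
    sumFin-1 (suc k) = cong suc (sumFin-1 k)
  -- To be read with `a` the number of edges between layers, `b` the degree sum inside layers, and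
  -- `c` the number of vertices other than the root.
  squeeze : ∀ {a b c n′} → a + b + a + 2 ≡ 2 * n′ → c ≤ a → n′ ≤ c + 1 → a ≤ c × b ≡ 0
  squeeze {a} {b} {c} {n′} eq c≤a n≤ = a≤c , ℕ.n≤0⇒n≡0 b≤0
    where
    bound : a + b + a + 2 ≤ c + c + 2
    bound = ℕ.≤-trans (ℕ.≤-reflexive eq) (ℕ.≤-trans (ℕ.*-monoʳ-≤ 2 n≤)
      (ℕ.≤-reflexive (solve 1 (λ c → con 2 :* (c :+ con 1) := c :+ c :+ con 2) refl c)))
    bound′ : a + b + a ≤ c + c
    bound′ = ℕ.+-cancelʳ-≤ 2 _ _ bound
    a≤c : a ≤ c
    a≤c = ℕ.+-cancelˡ-≤ c _ _ (ℕ.≤-trans (ℕ.+-monoˡ-≤ a (ℕ.≤-trans c≤a (ℕ.m≤m+n a b))) bound′)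
    b≤0 : b ≤ 0
    b≤0 = ℕ.+-cancelˡ-≤ (c + c) _ _ (ℕ.≤-trans (ℕ.≤-trans (ℕ.+-monoˡ-≤ b (ℕ.+-mono-≤ c≤a c≤a))
      (ℕ.≤-reflexive (solve 2 (λ a b → a :+ a :+ b := a :+ b :+ a) refl a b))) (ℕ.≤-trans bound′ (ℕ.≤-reflexive (sym (ℕ.+-identityʳ (c + c))))))
  tight : Σlower ≤ sumFin N others × Σlevel ≡ 0
  tight = squeeze total (sumFin-mono N others≤lower) Σothers
  lower≤1 : ∀ v → ∣ lower v ∣ ≤ 1
  lower≤1 v = ℕ.≤-trans (sumFin-tight N others≤lower (proj₁ tight) v) (indicator≤1 (not (does (v Fin.≟ root))))
    where
    indicator≤1 : ∀ b → indicator b ≤ 1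
    indicator≤1 true  = ℕ.≤-refl
    indicator≤1 false = z≤n
  tree-edge′ : ∀ {x y} → adjacent y x → depth x < depth y → y ≢ root × x ≡ parent y
  tree-edge′ {x} {y} e lt = y≢root , sym (proj₂ (injection-onto′ (lower∋ e lt)))
    where
    y≢root : y ≢ root
    y≢root refl = ℕ.n≮0 (subst (depth x <_) depth-root lt)
    lower∋ : ∀ {z} → adjacent y z → depth z < depth y → z ∈ lower y
    lower∋ {z} e lt = cong₂ _∧_ e (dec-true (depth z <? depth y) lt)
    injection-onto′ : ∀ {z} → z ∈ lower y → ∃[ i ] (λ (_ : Fin 1) → parent y) i ≡ z
    injection-onto′ = injection-onto (lower y) (λ (_ : Fin 1) → parent y) (λ { {zero} {zero} _ → refl })
      (λ _ → let e , lt = parent-spec y≢root in lower∋ e lt) (lower≤1 y)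
  tree-edge : ∀ {x y} → adj T x y ≡ true → (y ≢ root × x ≡ parent y) ⊎ (x ≢ root × y ≡ parent x)
  tree-edge {x} {y} e with ℕ.<-cmp (depth x) (depth y)
  ... | tri< lt _ _ = inj₁ (tree-edge′ (trans (Graph.sym T y x) e) lt)
  ... | tri> _ _ gt = inj₂ (tree-edge′ e gt)
  ... | tri≈ _ eq _ = contradiction (ℕ.≤-trans (∈⇒0<∣∣ (level x) {y} (cong₂ _∧_ e (dec-true (depth y ℕ.≟ depth x) (sym eq)))) (≤sumFin N (∣_∣ ∘ level) x))
                        (ℕ.<⇒≱ (s≤s (ℕ.≤-reflexive (proj₂ tight))))

-- Separators along a tree decomposition

module Ancestors {T : Graph} (R : Rooted T) where

  open Rooted R

  data Anc (x : V T) : V T → Set where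
    self : Anc x x
    up   : ∀ {z} → z ≢ root → Anc x (parent z) → Anc x z

  anc? : ∀ x z → Dec (Anc x z)
  anc? x z = go-up (depth z) z ℕ.≤-refl
    where
    go-up : ∀ k z → depth z ≤ k → Dec (Anc x z)
    go-up k z le with z Fin.≟ x | z Fin.≟ root
    ... | yes refl | _ = yes self
    ... | no z≢x | yes z≡r = no λ { self → z≢x refl ; (up z≢r _) → z≢r z≡r }
    go-up zero    z le | no z≢x | no z≢r = contradiction (ℕ.≤-trans (par-depth z≢r) le) λ ()
    go-up (suc k) z le | no z≢x | no z≢r =
      map′ (up z≢r) (λ { self → contradiction refl z≢x ; (up _ A) → A }) (go-up k (parent z) (ℕ.≤-pred (ℕ.≤-trans (par-depth z≢r) le)))

  anc-trans : ∀ {x y z} → Anc x y → Anc y z → Anc x z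
  anc-trans A self     = A
  anc-trans A (up n B) = up n (anc-trans A B)

  anc-depth : ∀ {x z} → Anc x z → depth x ≤ depth z
  anc-depth self     = ℕ.≤-refl
  anc-depth (up n A) = ℕ.≤-trans (anc-depth A) (ℕ.<⇒≤ (par-depth n))

  anc-antisym : ∀ {x z} → Anc x z → Anc z x → x ≡ z
  anc-antisym self     B = refl
  anc-antisym (up n A) B = contradiction (ℕ.<-≤-trans (ℕ.≤-<-trans (anc-depth A) (par-depth n)) (anc-depth B)) (ℕ.<-irrefl refl)

  anc-root : ∀ z → Anc root z
  anc-root z = from (depth z) z ℕ.≤-refl
    where
    from : ∀ k z → depth z ≤ k → Anc root z
    from k z le with z Fin.≟ root
    ... | yes refl = self
    from zero    z le | no ne = contradiction (ℕ.≤-trans (par-depth ne) le) λ ()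
    from (suc k) z le | no ne = up ne (from k (parent z) (ℕ.≤-pred (ℕ.≤-trans (par-depth ne) le)))

  ChildOf : V T → V T → Set
  ChildOf x c = c ≢ root × parent c ≡ x

  childOf? : ∀ x c → Dec (ChildOf x c)
  childOf? x c = ¬? (c Fin.≟ root) ×-dec (parent c Fin.≟ x)

  child-above : ∀ {x z} → Anc x z → z ≢ x → ∃[ c ] (ChildOf x c × Anc c z)
  child-above self ne = contradiction refl ne
  child-above {x} {z} (up n A) ne with parent z Fin.≟ x
  ... | yes e = z , (n , e) , self
  ... | no ne′ = let c , ch , B = child-above A ne′ in c , ch , up n B

  siblings-disjoint : ∀ {x c c′ z} → ChildOf x c → ChildOf x c′ → Anc c z → Anc c′ z → c ≡ c′
  siblings-disjoint ch ch′ self self = refl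
  siblings-disjoint (n , refl) (n′ , e′) self (up _ B) =
    contradiction (ℕ.≤-<-trans (anc-depth (subst (Anc _) (sym e′) B)) (par-depth n′)) (ℕ.<-irrefl refl)
  siblings-disjoint (n , refl) (n′ , e′) (up _ A) self =
    contradiction (ℕ.≤-<-trans (anc-depth (subst (Anc _) e′ A)) (par-depth n)) (ℕ.<-irrefl refl)
  siblings-disjoint ch ch′ (up _ A) (up _ B) = siblings-disjoint ch ch′ A B

-- A deepest node with at least low L vertices below it has at most high L of them: it has at most M children
-- that matter, each with fewer than low L vertices below it and at most b in its bag.
lowᴹ highᴹ : ℕ → ℕ → ℕ → ℕ
lowᴹ M b zero    = 0
lowᴹ M b (suc L) = suc (highᴹ M b L + b)
highᴹ M b L = M * (lowᴹ M b L + b)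

module Descent (G : Graph) {w} (td : TreeDecomp G w) (R : Rooted (TreeDecomp.tree td)) (H : Subgraph G) (t m : ℕ) (0<m : 0 < m) (C : ℕ)
  (noK : ¬ Minor (K (suc t) m) G)
  (noSmallIsland : ∀ X → (∀ {v} → v ∈ X → v ∈ Subgraph.S H) → (∃[ v ] v ∈ X) → ∣ X ∣ ≤ C → ∃[ v ] (v ∈ X × suc t ≤ ∣ Subgraph.F H v ∖ X ∣)) where

  open TreeDecomp td using (bag; bagSize; coherent; coverV; coverE) renaming (tree to T)
  open Subgraph H using (S; F)

  private
    n = Graph.n G
    b = suc w

  open Rooted R
  open Ancestors R

  F-sym : ∀ {u v} → F u v ≡ true → F v u ≡ true
  F-sym {u} {v} e = trans (Subgraph.Fsym H v u) e

  F⊆ : ∀ {u v} → F u v ≡ true → adj G u v ≡ true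
  F⊆ {u} {v} = Subgraph.Fsub H u v

  F⇒S : ∀ {u v} → F u v ≡ true → v ∈ S
  F⇒S {u} {v} e = Subgraph.Fend H v u (F-sym e)

  open Minors G F F⊆ F-sym

  Below : V T → Fin n → Set
  Below x v = ∃[ z ] (Anc x z × v ∈ bag z)

  below? : ∀ x v → Dec (Below x v)
  below? x v = Fin.any? (λ z → anc? x z ×-dec (v ∈? bag z))

  below-anc : ∀ {x y v} → Anc x y → Below y v → Below x v
  below-anc A (z , B , p) = z , anc-trans A B , p

  -- The bags containing `v` are connected in the tree. They could leave the subtree of `c` only
  -- across the edge to `parent c`, and then both of its ends would contain `v`.
  confined : ∀ {c v z} → (c ≢ root → v ∈ bag c → v ∉ bag (parent c)) → Below c v → v ∈ bag z → Anc c z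
  confined {c} {v} {z} cond (z₀ , A , p) q = along (coherent v z₀ z p q) A
    where
    first : ∀ {x y} → Reach T (λ z → bag z v) x y → v ∈ bag x
    first (here p) = p
    first (step p _ _) = p
    along : ∀ {x y} → Reach T (λ z → bag z v) x y → Anc c x → Anc c y
    along (here _) A = A
    along (step p e ρ) A with tree-edge e
    ... | inj₁ (ne , refl) = along ρ (up ne A)
    ... | inj₂ (ne , refl) with A
    ...   | self   = contradiction (first ρ) (cond ne p)
    ...   | up _ B = along ρ B

  -- `InD` leaves out the bag at the top of the subtree, which separates it from the rest.
  -- `InBranch` leaves out the parent's bag instead, so that the branches of the children of `x`
  -- cover `D x`.
  InD InBranch : V T → Fin n → Set
  InD x v = v ∈ S × v ∉ bag x × Below x v
  InBranch c v = v ∈ S × v ∉ bag (parent c) × Below c v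

  inD? : ∀ x v → Dec (InD x v)
  inD? x v = (v ∈? S) ×-dec ¬? (v ∈? bag x) ×-dec below? x v

  inBranch? : ∀ c v → Dec (InBranch c v)
  inBranch? c v = (v ∈? S) ×-dec ¬? (v ∈? bag (parent c)) ×-dec below? c v

  B : V T → FSet n
  B x = bag x ∩ S

  abstract
    D branch : V T → FSet n
    D x v      = does (inD? x v)
    branch c v = does (inBranch? c v)

    D⁺ : ∀ {x v} → InD x v → v ∈ D x
    D⁺ {x} {v} = dec-true (inD? x v)

    D⁻ : ∀ {x v} → v ∈ D x → InD x v
    D⁻ {x} {v} = does⇒ (inD? x v)

    branch⁺ : ∀ {c v} → InBranch c v → v ∈ branch c
    branch⁺ {c} {v} = dec-true (inBranch? c v)

    branch⁻ : ∀ {c v} → v ∈ branch c → InBranch c v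
    branch⁻ {c} {v} = does⇒ (inBranch? c v)

  D-closed : ∀ {x u v} → u ∈ D x → F u v ≡ true → v ∈ D x ⊎ v ∈ B x
  D-closed {x} {u} {v} p e with D⁻ {x} p | v ∈? bag x | coverE u v (F⊆ e)
  ... | _ | yes q | _ = inj₂ (∩⁺ (bag x) S q (F⇒S e))
  ... | _ , u∉ , below | no q | z , u∈z , v∈z = inj₁ (D⁺ (F⇒S e , q , z , confined (λ _ u∈ → contradiction u∈ u∉) below u∈z , v∈z))

  child-branch⁻ : ∀ {x c v} → ChildOf x c → v ∈ branch c → Below c v × v ∉ bag x
  child-branch⁻ {c = c} (_ , refl) p = let _ , v∉ , below = branch⁻ {c} p in below , v∉

  branch-closed : ∀ {x c u v} → ChildOf x c → u ∈ branch c → F u v ≡ true → v ∈ branch c ⊎ v ∈ bag x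
  branch-closed {_} {c} {u} {v} (_ , refl) p e with branch⁻ {c} p | v ∈? bag (parent c) | coverE u v (F⊆ e)
  ... | _ | yes q | _ = inj₂ q
  ... | _ , u∉ , below | no q | z , u∈z , v∈z = inj₁ (branch⁺ (F⇒S e , q , z , confined (λ _ _ → u∉) below u∈z , v∈z))

  D⊆D : ∀ {x y v} → Anc x y → v ∈ D y → v ∈ D x
  D⊆D {x} {y} A p with D⁻ {y} p
  ... | v∈S , v∉y , below = D⁺ (v∈S , (λ v∈x → v∉y (subst (λ z → _ ∈ bag z) (anc-antisym A (confined (λ _ v∈y → contradiction v∈y v∉y) below v∈x)) v∈x)) , below-anc A below)

  B⊆U : ∀ {x y v} → Anc x y → v ∈ B y → v ∈ D x ⊎ v ∈ B x
  B⊆U {x} {y} {v} A p with ∩⁻ (bag y) S p | v ∈? bag x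
  ... | _ , v∈S | yes q = inj₂ (∩⁺ (bag x) S q v∈S)
  ... | v∈y , v∈S | no q = inj₁ (D⁺ (v∈S , q , y , A , v∈y))

  ∣B∣≤ : ∀ x → ∣ B x ∣ ≤ b
  ∣B∣≤ x = ℕ.≤-trans (∣∣-mono (B x) (bag x) (proj₁ ∘ ∩⁻ (bag x) S)) (bagSize x)

  ∣branch∣≤ : ∀ c → ∣ branch c ∣ ≤ ∣ D c ∣ + b
  ∣branch∣≤ c = ℕ.≤-trans (∣∣-cover (branch c) (D c) (bag c) split) (ℕ.+-monoʳ-≤ ∣ D c ∣ (bagSize c))
    where
    split : ∀ {v} → v ∈ branch c → v ∈ D c ⊎ v ∈ bag c
    split {v} p with v ∈? bag c | branch⁻ {c} p
    ... | yes q | _ = inj₂ q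
    ... | no q  | v∈S , _ , below = inj₁ (D⁺ (v∈S , q , below))

  busy? : ∀ x c → Dec (ChildOf x c × ∃[ v ] v ∈ branch c)
  busy? x c = childOf? x c ×-dec Fin.any? (λ v → v ∈? branch c)

  busyChildren : V T → FSet (Graph.n T)
  busyChildren x c = does (busy? x c)

  M : ℕ
  M = m * 2 ^ b

  -- Each child contributes a vertex with more than t neighbours in the bag of x; too many children would give K_{t+1,m}.
  few-children : ∀ x → (∀ {c} → ChildOf x c → ∣ branch c ∣ ≤ C) → ∣ busyChildren x ∣ ≤ M
  few-children x small with ∣ busyChildren x ∣ ≤? M
  ... | yes le = le
  ... | no gt = ⊥-elim (noK (common-neighbours⇒K 0<m (λ i → ⁅ nth (bag x) i ⁆) (λ i → nth (bag x) i , ⁅⁆⁺ (nth (bag x) i))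
      (λ {i} {j} {v} p q → nth-injective (bag x) (trans (sym (⁅⁆⁻ {v = v} p)) (⁅⁆⁻ q)))
      (λ i → singleton-connected (nth (bag x) i)) v
      distinct
      (λ {r} i lt p → let _ , _ , _ , _ , _ , _ , v∉ , _ = spec r (up-M lt) in v∉ (subst (_∈ bag x) (sym (⁅⁆⁻ p)) (nth-∈ (bag x) i)))
      (λ {r} lt → let _ , _ , _ , _ , _ , _ , _ , nbrs = spec r (up-M lt) in nbrs)))
    where
    picked = choose (busyChildren x) (ℕ.≰⇒> gt)
    f = proj₁ picked
    Good : ℕ → Fin n → Set
    Good r v = ∃[ i ] (toℕ i ≡ r × ∃[ c ] (f i ≡ c × ChildOf x c × Below c v × v ∉ bag x ×
      Σ (Fin (suc t) → Fin ∣ bag x ∣) λ lab → Inj lab × (∀ j → Neighbour ⁅ nth (bag x) (lab j) ⁆ v)))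
    good : ∀ i → ∃ (Good (toℕ i))
    good i with does⇒ (busy? x (f i)) (proj₂ (proj₂ picked) i)
    ... | ch , some with noSmallIsland (branch (f i)) (λ p → proj₁ (branch⁻ {f i} p)) some (small ch)
    ...   | v , v∈E , many with choose (F v ∖ branch (f i)) many
    ...     | u , u-inj , u∈ = v , i , refl , f i , refl , ch , proj₁ (child-branch⁻ ch v∈E) , proj₂ (child-branch⁻ ch v∈E) ,
        proj₁ ∘ at , (λ {j} {j′} e → u-inj (trans (sym (proj₂ (at j))) (trans (cong (nth (bag x)) e) (proj₂ (at j′))))) ,
        λ j → u j , subst (λ z → u j ∈ ⁅ z ⁆) (sym (proj₂ (at j))) (⁅⁆⁺ (u j)) , F-sym (proj₁ (∖⁻ (F v) (branch (f i)) (u∈ j)))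
      where
      at : ∀ j → ∃[ l ] nth (bag x) l ≡ u j
      at j with ∖⁻ (F v) (branch (f i)) (u∈ j)
      ... | e , u∉ = nth-surjective (bag x) ([ (λ p → contradiction p u∉) , id ]′ (branch-closed ch v∈E e))
    abstract
      family : Σ (ℕ → Fin n) λ v → ∀ r → r ≤ M → Good r (v r)
      family = tabulate≤ M (proj₁ (good zero)) λ r le → subst (∃ ∘ Good) (Fin.toℕ-fromℕ< (s≤s le)) (good (fromℕ< (s≤s le)))
    v = proj₁ family
    spec = proj₂ family
    up-M : ∀ {r} → r < m * 2 ^ ∣ bag x ∣ → r ≤ M
    up-M lt = ℕ.≤-trans (ℕ.<⇒≤ lt) (ℕ.*-monoʳ-≤ m (ℕ.^-monoʳ-≤ 2 (bagSize x)))
    distinct : ∀ {i j} → i < j → j < m * 2 ^ ∣ bag x ∣ → v i ≢ v j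
    distinct {i} {j} lt lt′ e with spec i (up-M (ℕ.<-trans lt lt′)) | spec j (up-M lt′)
    ... | i′ , ei , c , fi , ch , (z , A , v∈z) , v∉ , _ | j′ , ej , c′ , fj , ch′ , below , v∉′ , _ =
      ℕ.<⇒≢ lt (trans (sym ei) (trans (cong toℕ (proj₁ (proj₂ picked) (trans fi (trans c≡c′ (sym fj))))) ej))
      where
      c≡c′ : c ≡ c′
      c≡c′ = siblings-disjoint ch ch′ A (confined (λ _ _ → subst (λ z → v j ∉ bag z) (sym (proj₂ ch′)) v∉′) below (subst (_∈ bag z) e v∈z))

  D-bound : ∀ x g → (∀ {c} → ChildOf x c → ∣ D c ∣ ≤ g) → g + b ≤ C → ∣ D x ∣ ≤ M * (g + b)
  D-bound x g small le = ℕ.≤-trans (∣∣-⋃ (D x) (busyChildren x) branch (g + b) cov (λ {c} p → branch≤ (proj₁ (does⇒ (busy? x c) p))))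
    (ℕ.*-monoˡ-≤ (g + b) (few-children x (λ ch → ℕ.≤-trans (branch≤ ch) le)))
    where
    branch≤ : ∀ {c} → ChildOf x c → ∣ branch c ∣ ≤ g + b
    branch≤ {c} ch = ℕ.≤-trans (∣branch∣≤ c) (ℕ.+-monoˡ-≤ b (small ch))
    cov : ∀ {v} → v ∈ D x → ∃[ c ] (c ∈ busyChildren x × v ∈ branch c)
    cov {v} p with D⁻ {x} p
    ... | v∈S , v∉x , z , A , v∈z with child-above A (λ { refl → v∉x v∈z })
    ...   | c , ch@(_ , refl) , A′ = c , dec-true (busy? x c) (ch , v , v∈E) , v∈E
      where
      v∈E : v ∈ branch c
      v∈E = branch⁺ (v∈S , v∉x , z , A′ , v∈z)

  low high : ℕ → ℕ
  low  = lowᴹ M b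
  high = highᴹ M b

  0<M : 0 < M
  0<M = ℕ.*-mono-≤ {1} {m} {1} 0<m (ℕ.^-monoʳ-≤ 2 {0} {b} z≤n)

  ≤M* : ∀ x → x ≤ M * x
  ≤M* x = ℕ.≤-trans (ℕ.≤-reflexive (sym (ℕ.*-identityˡ x))) (ℕ.*-monoˡ-≤ x 0<M)

  high-mono : ∀ L → high L ≤ high (suc L)
  high-mono L = ℕ.≤-trans (ℕ.≤-trans (ℕ.m≤m+n (high L) b) (ℕ.n≤1+n _)) (ℕ.≤-trans (ℕ.m≤m+n _ b) (≤M* _))

  -- A drop by more than `b` ensures that `D (node j)` and the at most `b` vertices of `B (node j)`
  -- cannot exhaust `D (node i)`, which yields the gaps of a chain.
  record Path (L : ℕ) (x : V T) : Set where
    field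
      node  : ℕ → V T
      start : Anc x (node 0)
      anc   : ∀ {i j} → i ≤ j → j ≤ L → Anc (node i) (node j)
      size  : ∀ {i j} → i < j → j ≤ L → ∣ D (node j) ∣ + b < ∣ D (node i) ∣
      small : ∀ {i} → i ≤ L → ∣ D (node i) ∣ ≤ high L

  -- A crude bound on all depths, the fuel for the descent.
  Δ : ℕ
  Δ = sumFin (Graph.n T) depth

  -- Go down as long as some child still has at least low L vertices below it.
  descend : ∀ L k x → Δ ≤ depth x + k → low L ≤ ∣ D x ∣ → high L ≤ C → Path L x
  descend L k x fuel big hC with Fin.any? (λ c → childOf? x c ×-dec (low L ≤? ∣ D c ∣))
  descend L zero x fuel big hC | yes (c , (ne , refl) , _) =
    contradiction (ℕ.≤-trans (≤sumFin _ depth c) (ℕ.≤-trans fuel (ℕ.≤-reflexive (ℕ.+-identityʳ _)))) (ℕ.<⇒≱ (par-depth ne))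
  descend L (suc k) x fuel big hC | yes (c , (ne , refl) , big′) =
    record { Path p ; start = anc-trans (up ne self) (Path.start p) }
    where
    p = descend L k c (ℕ.≤-trans fuel (ℕ.≤-trans (ℕ.≤-reflexive (ℕ.+-suc (depth (parent c)) k)) (ℕ.+-monoˡ-≤ k (par-depth ne)))) big′ hC
  descend zero k x fuel big hC | no none = record
    { node = λ _ → x ; start = self ; anc = λ _ _ → self ; size = λ { {j = zero} () ; {j = suc _} _ () }
    -- As `low 0` is 0, `none` says that `x` has no children at all.
    ; small = λ _ → D-bound x 0 (λ {c} ch → contradiction (c , ch , z≤n) none) (ℕ.≤-trans (≤M* _) hC) }
  descend (suc L) k x fuel big hC | no none with Fin.any? (λ c → childOf? x c ×-dec (low L ≤? ∣ D c ∣))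
  -- With only small children, `D x` would have at most `high L` vertices, fewer than `low (suc L)`.
  ... | no none′ = contradiction (ℕ.≤-trans big (ℕ.≤-trans (D-bound x (low L) (λ {c} ch → ℕ.<⇒≤ (ℕ.≰⇒> λ le → none′ (c , ch , le)))
        (ℕ.≤-trans (≤M* _) hC′)) (ℕ.m≤m+n (high L) b))) (ℕ.<⇒≱ ℕ.≤-refl)
    where
    hC′ : high L ≤ C
    hC′ = ℕ.≤-trans (high-mono L) hC
  ... | yes (c , (ne , refl) , big′) = record
    { node = node′ ; start = self ; anc = anc′ ; size = size′ ; small = small′ }
    where
    p = descend L Δ c (ℕ.m≤n+m Δ (depth c)) big′ (ℕ.≤-trans (high-mono L) hC)
    open Path p
    node′ : ℕ → V T
    node′ zero    = x
    node′ (suc i) = node i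
    anc′ : ∀ {i j} → i ≤ j → j ≤ suc L → Anc (node′ i) (node′ j)
    anc′ {zero}  {zero}  _ _ = self
    anc′ {zero}  {suc j} _ (s≤s le) = anc-trans (anc-trans (up ne self) start) (anc z≤n le)
    anc′ {suc i} {suc j} (s≤s le) (s≤s le′) = anc le le′
    size′ : ∀ {i j} → i < j → j ≤ suc L → ∣ D (node′ j) ∣ + b < ∣ D (node′ i) ∣
    size′ {zero}  {suc j} _ (s≤s le) = ℕ.≤-trans (s≤s (ℕ.+-monoˡ-≤ b (small le))) big
    size′ {suc i} {suc j} (s≤s lt) (s≤s le) = size lt le
    small′ : ∀ {i} → i ≤ suc L → ∣ D (node′ i) ∣ ≤ high (suc L)
    small′ {zero}  _ = D-bound x (low (suc L)) (λ {c} ch → ℕ.<⇒≤ (ℕ.≰⇒> λ le → none (c , ch , le))) (ℕ.≤-trans (≤M* _) hC)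
    small′ {suc i} (s≤s le) = ℕ.≤-trans (small le) (high-mono L)

  path⇒chain : ∀ {L x} (p : Path L x) → Chains.Chain F F-sym (D (Path.node p 0)) {0} (λ ()) b L
  path⇒chain {L} p = record
    { D = D ∘ node ; B = B ∘ node
    ; closed = λ {i} _ d e → [ inj₁ , inj₂ ∘ inj₁ ]′ (D-closed {node i} d e)
    ; DB = λ {i} _ d q → proj₁ (proj₂ (D⁻ {node i} d)) (proj₁ (∩⁻ (bag (node i)) S q))
    ; Da = λ () ; Ba = λ ()
    ; D⊆ = λ le le′ → D⊆D (anc le le′)
    ; B⊆ = λ le le′ → B⊆U (anc le le′)
    ; gap = gap′
    ; small = λ {i} _ → ∣B∣≤ (node i)
    ; inTop = id }
    where
    open Path p
    gap′ : ∀ {i j} → i < j → j ≤ L → ∃[ v ] (v ∈ D (node i) × v ∉ D (node j) × v ∉ B (node j))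
    gap′ {i} {j} lt le with ∣∣>⇒∃∖ (D (node i)) (D (node j) ∪ B (node j))
      (ℕ.≤-<-trans (ℕ.≤-trans (∣∪∣≤ (D (node j)) (B (node j))) (ℕ.+-monoʳ-≤ _ (∣B∣≤ (node j)))) (size lt le))
    ... | v , p , q = v , p , q ∘ ∪⁺ˡ (D (node j)) (B (node j)) , q ∘ ∪⁺ʳ (D (node j)) (B (node j))

  -- If fewer than low L vertices lie below the root, then all of S is an island.
  long-path : ∀ L → NonEmptySub H → high L ≤ C → Path L root
  long-path L ne hC with low L ≤? ∣ D root ∣
  ... | yes big = descend L Δ root (ℕ.m≤n+m Δ _) big hC
  ... | no few with noSmallIsland S id ne (ℕ.≤-trans ∣S∣≤ (ℕ.≤-trans (≤M* _) hC))
    where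
    cov : ∀ {v} → v ∈ S → v ∈ D root ⊎ v ∈ bag root
    cov {v} v∈S with v ∈? bag root | coverV v
    ... | yes q | _ = inj₂ q
    ... | no q | z , v∈z = inj₁ (D⁺ (v∈S , q , z , anc-root z , v∈z))
    ∣S∣≤ : ∣ S ∣ ≤ low L + b
    ∣S∣≤ = ℕ.≤-trans (∣∣-cover S (D root) (bag root) cov) (ℕ.+-mono-≤ (ℕ.<⇒≤ (ℕ.≰⇒> few)) (bagSize root))
  ...   | v , _ , many = contradiction (ℕ.≤-trans many (ℕ.≤-reflexive (∣∅∣ (F v ∖ S) λ u p → let e , q = ∖⁻ (F v) S p in q (F⇒S e)))) λ ()

-- Islands

island? : ∀ {G} (H : Subgraph G) t X → Dec (IsIsland H t X)
island? H t X = Fin.all? (λ v → (v ∈? X) →-dec (v ∈? Subgraph.S H)) ×-dec Fin.any? (λ v → v ∈? X) ×-dec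
  Fin.all? (λ v → (v ∈? X) →-dec (∣ Subgraph.F H v ∖ X ∣ <? t))

-- There are finitely many vertex sets, so the case distinction is constructive. The search runs
-- over vectors, hence the passage through `tabulate`.
smallIsland? : ∀ {G} (H : Subgraph G) t C → (∃[ X ] (IsIsland H t X × ∣ X ∣ ≤ C)) ⊎
  (∀ X → (∀ {v} → v ∈ X → v ∈ Subgraph.S H) → (∃[ v ] v ∈ X) → ∣ X ∣ ≤ C → ∃[ v ] (v ∈ X × t ≤ ∣ Subgraph.F H v ∖ X ∣))
smallIsland? {G} H t C with anySubset? (λ s → island? H t (lookup s) ×-dec (∣ lookup s ∣ ≤? C))
... | yes (s , p) = inj₁ (lookup s , p)
... | no none = inj₂ escape
  where
  escape : ∀ X → (∀ {v} → v ∈ X → v ∈ Subgraph.S H) → (∃[ v ] v ∈ X) → ∣ X ∣ ≤ C → ∃[ v ] (v ∈ X × t ≤ ∣ Subgraph.F H v ∖ X ∣)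
  escape X X⊆S (v₀ , v₀∈X) small with Fin.any? (λ v → (v ∈? X) ×-dec (t ≤? ∣ Subgraph.F H v ∖ X ∣))
  ... | yes p = p
  ... | no none′ = contradiction (tabulate X , ((λ v → X⊆S ∘ to) , (v₀ , from v₀∈X) , few) , ℕ.≤-trans (∣∣-mono Y X to) small) none
    where
    Y : FSet (Graph.n G)
    Y = lookup (tabulate X)
    to : ∀ {v} → v ∈ Y → v ∈ X
    to {v} p = trans (sym (lookup∘tabulate X v)) p
    from : ∀ {v} → v ∈ X → v ∈ Y
    from {v} p = trans (lookup∘tabulate X v) p
    few : ∀ v → v ∈ Y → ∣ Subgraph.F H v ∖ Y ∣ < t
    few v p = ℕ.≤-<-trans (∣∣-mono (Subgraph.F H v ∖ Y) (Subgraph.F H v ∖ X) λ q → let e , u∉ = ∖⁻ (Subgraph.F H v) Y q in ∖⁺ (Subgraph.F H v) X e (u∉ ∘ from))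
      (ℕ.≰⇒> λ le → none′ (v , to p , le))

chainLength : ℕ → ℕ → ℕ
chainLength m b = len (windows m b * 4 + 3) b

-- `highᴹ` bounds every set on which the absence of islands is invoked: branches, the vertices below
-- the first separator, and all of `S` in the degenerate case.
islandSize : ℕ → ℕ → ℕ
islandSize m b = suc (highᴹ (m * 2 ^ b) b (chainLength m b))

excluded⇒islands : ∀ {G w m} t → 0 < m → TreeDecomp G w → ¬ Minor (K (suc t) m) G → ¬ Minor (IP t m) G →
  IslandProp (islandSize m (suc w)) (suc t) G
excluded⇒islands {G} {w} {m} t 0<m td noK noIP H ne with smallIsland? H (suc t) (islandSize m (suc w))
... | inj₁ p = p
... | inj₂ escape = ⊥-elim ([ noK , noIP ]′ minor)
  where
  b = suc w
  L = chainLength m b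
  open Descent G td (rooted _ (TreeDecomp.isTree td)) H t m 0<m (islandSize m b) noK escape
  p : Path L _
  p = long-path L ne (ℕ.n≤1+n _)
  top = D (Path.node p 0)
  noIsland : ∀ X → X ⊆ top → (∃[ v ] v ∈ X) → ∃[ v ] (v ∈ X × suc t ≤ ∣ Subgraph.F H v ∖ X ∣)
  noIsland X X⊆ some = escape X (λ v∈X → proj₁ (D⁻ {Path.node p 0} (X⊆ v∈X))) some
    (ℕ.≤-trans (∣∣-mono X top X⊆) (ℕ.≤-trans (Path.small p z≤n) (ℕ.n≤1+n _)))
  minor : Minor (K (suc t) m) G ⊎ Minor (IP t m) G
  minor = Final.linked⇒minor G (Subgraph.F H) F⊆ F-sym top t noIsland 0<m
    (Chains.refine (Subgraph.F H) F-sym top (windows m b * 4 + 3) b ℕ.≤-refl (λ { {()} }) (path⇒chain p))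

-- Necessity: the excluded graphs have no small islands

whole : ∀ G → Subgraph G
whole G = record { S = λ _ → true ; F = adj G ; Fsym = Graph.sym G ; Fsub = λ _ _ e → e ; Fend = λ _ _ _ → refl }

private
  ≡ᵇ-true : ∀ a b → (a ≡ᵇ b) ≡ true → a ≡ b
  ≡ᵇ-true a b e = ℕ.≡ᵇ⇒≡ a b (subst So (sym e) _)

  sides-differ : ∀ {t m} (i : Fin t) (j : Fin m) → (toℕ (i ↑ˡ m) ≡ᵇ toℕ (t ↑ʳ j)) ≡ false
  sides-differ {t} {m} i j with toℕ (i ↑ˡ m) ≡ᵇ toℕ (t ↑ʳ j) in e
  ... | false = refl
  ... | true  = case trans (sym (<ᵇ-left (i ↑ˡ m) (Fin.splitAt-↑ˡ t i m))) (trans (cong (_<ᵇ t) (≡ᵇ-true (toℕ (i ↑ˡ m)) _ e)) (<ᵇ-right (t ↑ʳ j) (Fin.splitAt-↑ʳ t m j))) of λ ()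

  K-adj : ∀ {t m} (i : Fin t) (j : Fin m) → adj (K t m) (i ↑ˡ m) (t ↑ʳ j) ≡ true
  K-adj {t} {m} i j rewrite <ᵇ-left (i ↑ˡ m) (Fin.splitAt-↑ˡ t i m) | <ᵇ-right (t ↑ʳ j) (Fin.splitAt-↑ʳ t m j) | sides-differ i j = refl

  IP-adj : ∀ {t m} (i : Fin t) (j : Fin m) → adj (IP t m) (i ↑ˡ m) (t ↑ʳ j) ≡ true
  IP-adj {t} {m} i j rewrite <ᵇ-left (i ↑ˡ m) (Fin.splitAt-↑ˡ t i m) | <ᵇ-right (t ↑ʳ j) (Fin.splitAt-↑ʳ t m j) | sides-differ i j = refl

  IP-path : ∀ {t m} (i j : Fin m) → toℕ j ≡ suc (toℕ i) → adj (IP t m) (t ↑ʳ i) (t ↑ʳ j) ≡ true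
  IP-path {t} {m} i j e rewrite <ᵇ-right (t ↑ʳ i) (Fin.splitAt-↑ʳ t m i) | <ᵇ-right (t ↑ʳ j) (Fin.splitAt-↑ʳ t m j)
    | Fin.toℕ-↑ʳ t i | Fin.toℕ-↑ʳ t j | e | ℕ.+-suc t (toℕ i) = consecutive (t + toℕ i)
    where
    consecutive : ∀ a → ((a ≡ᵇ a) ∨ (a ≡ᵇ suc (suc a))) ∧ not (a ≡ᵇ suc a) ≡ true
    consecutive zero = refl
    consecutive (suc a) = consecutive a

  -- A predicate that changes along a path changes between two consecutive vertices, in one
  -- direction or the other.
  boundary : ∀ {m} (p : Fin m → Bool) {i j} → p i ≡ true → p j ≡ false →
    ∃[ a ] ∃[ b ] (p a ≡ true × p b ≡ false × (toℕ b ≡ suc (toℕ a) ⊎ toℕ a ≡ suc (toℕ b)))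
  boundary p {zero}  {zero}  x y = case trans (sym x) y of λ ()
  boundary p {suc i} {suc j} x y = let a , b , q , r , s = boundary (p ∘ suc) x y in
    suc a , suc b , q , r , [ inj₁ ∘ cong suc , inj₂ ∘ cong suc ]′ s
  boundary {suc (suc m)} p {zero} {suc j} x y with p (suc zero) in e
  ... | false = zero , suc zero , x , e , inj₁ refl
  ... | true  = let a , b , q , r , s = boundary (p ∘ suc) {zero} {j} e y in suc a , suc b , q , r , [ inj₁ ∘ cong suc , inj₂ ∘ cong suc ]′ s
  boundary {suc (suc m)} p {suc i} {zero} x y with p (suc zero) in e
  ... | true  = suc zero , zero , e , y , inj₂ refl
  ... | false = let a , b , q , r , s = boundary (p ∘ suc) {i} {zero} x e in suc a , suc b , q , r , [ inj₁ ∘ cong suc , inj₂ ∘ cong suc ]′ s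

module _ (G : Graph) {t t′ C} (t′≤t : t′ ≤ t) {X : FSet (Graph.n G)} (island : IsIsland (whole G) t′ X) (small : ∣ X ∣ ≤ C) where

  few-outside : ∀ {v k} → v ∈ X → (f : Fin k → V G) → Inj f → (∀ i → adj G v (f i) ≡ true) → (∀ i → f i ∉ X) → k < t
  few-outside {v} v∈X f inj nbr out = ℕ.≤-trans
    (ℕ.≤-<-trans (injection⇒≤∣∣ (adj G v ∖ X) f inj λ i → ∖⁺ (adj G v) X (nbr i) (out i)) (proj₂ (proj₂ island) v v∈X)) t′≤t

  -- A vertex of the island has fewer than `t` neighbours outside it and at most `C` inside, so its
  -- degree is below `t + C`.
  hub∉ : ∀ {v} → (f : Fin (t + C) → V G) → Inj f → (∀ i → adj G v (f i) ≡ true) → v ∉ X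
  hub∉ {v} f inj nbr v∈X = contradiction (injection⇒≤∣∣ (adj G v) f inj nbr) (ℕ.<⇒≱ (ℕ.≤-<-trans (∣∣-cover (adj G v) (adj G v ∖ X) X split)
    (ℕ.+-mono-<-≤ (ℕ.≤-trans (proj₂ (proj₂ island) v v∈X) t′≤t) small)))
    where
    split : ∀ {u} → u ∈ adj G v → u ∈ adj G v ∖ X ⊎ u ∈ X
    split {u} p with u ∈? X
    ... | yes q = inj₂ q
    ... | no q  = inj₁ (∖⁺ (adj G v) X p q)

↑ˡ-inj : ∀ {t m} → Inj (λ (i : Fin t) → i ↑ˡ m)
↑ˡ-inj {m = m} = Fin.↑ˡ-injective m _ _

↑ʳ-inj : ∀ {t m} → Inj (λ (j : Fin m) → t ↑ʳ j)
↑ʳ-inj {t} = Fin.↑ʳ-injective t _ _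

-- The left vertices have degree `suc t + C` and are excluded by `hub∉`; a right vertex then has all
-- its `suc t` neighbours outside.
K-no-islands : ∀ {t t′ C} → t′ ≤ suc t → ¬ IslandProp C t′ (K (suc t) (suc t + C))
K-no-islands {t} {t′} {C} t′≤ isl with isl (whole (K (suc t) (suc t + C))) (zero , refl)
... | X , island@(_ , (v , v∈X) , _) , small with splitAt (suc t) v in ev
...   | inj₁ i = left∉ i (subst (_∈ X) (sym (Fin.splitAt⁻¹-↑ˡ {suc t} ev)) v∈X)
  where
  left∉ : ∀ i → i ↑ˡ (suc t + C) ∉ X
  left∉ i = hub∉ (K (suc t) (suc t + C)) t′≤ island small (suc t ↑ʳ_) ↑ʳ-inj (K-adj i)
...   | inj₂ j = ℕ.<-irrefl refl (few-outside (K (suc t) (suc t + C)) t′≤ island small (subst (_∈ X) (sym (Fin.splitAt⁻¹-↑ʳ {suc t} ev)) v∈X)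
        (_↑ˡ (suc t + C)) ↑ˡ-inj (λ i → trans (Graph.sym (K (suc t) (suc t + C)) (suc t ↑ʳ j) (i ↑ˡ _)) (K-adj i j))
        (λ i → hub∉ (K (suc t) (suc t + C)) t′≤ island small (suc t ↑ʳ_) ↑ʳ-inj (K-adj i)))

-- The apices are excluded by `hub∉`, and the path has more than `C` vertices. So the island ends
-- somewhere along the path, where a vertex has a path neighbour and all `t` apices outside.
IP-no-islands : ∀ {t t′ C} → t′ ≤ suc t → ¬ IslandProp C t′ (IP t (suc t + C))
IP-no-islands {t} {t′} {C} t′≤ isl with isl (whole (IP t (suc t + C))) (t ↑ʳ zero , refl)
... | X , island@(_ , (v , v∈X) , _) , small = impossible
  where
  m = suc t + C
  left∉ : ∀ i → i ↑ˡ m ∉ X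
  left∉ i = hub∉ (IP t m) t′≤ island small (t ↑ʳ_) ↑ʳ-inj (IP-adj i)
  right∈ : ∃[ j ] t ↑ʳ j ∈ X
  right∈ with splitAt t v in ev
  ... | inj₁ i = contradiction (subst (_∈ X) (sym (Fin.splitAt⁻¹-↑ˡ {t} ev)) v∈X) (left∉ i)
  ... | inj₂ j = j , subst (_∈ X) (sym (Fin.splitAt⁻¹-↑ʳ {t} ev)) v∈X
  right∉ : ∃[ j ] X (t ↑ʳ j) ≡ false
  right∉ with Fin.any? (λ j → X (t ↑ʳ j) 𝔹.≟ false)
  ... | yes p = p
  ... | no none = contradiction (injection⇒≤∣∣ X (t ↑ʳ_) ↑ʳ-inj (λ j → 𝔹.¬-not (none ∘ (j ,_)))) (ℕ.<⇒≱ (s≤s (ℕ.≤-trans small (ℕ.m≤n+m C t))))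
  impossible : ⊥
  impossible with boundary (X ∘ (t ↑ʳ_)) (proj₂ right∈) (proj₂ right∉)
  ... | a , b , a∈X , b∉X , near = ℕ.<-irrefl refl (few-outside (IP t m) t′≤ island small a∈X f f-inj f-adj f∉)
    where
    f : Fin (suc t) → Fin (t + m)
    f zero    = t ↑ʳ b
    f (suc i) = i ↑ˡ m
    sides : ∀ {i j} → t ↑ʳ j ≢ i ↑ˡ m
    sides {i} {j} e = case trans (sym (sides-differ i j)) (trans (cong (λ x → toℕ (i ↑ˡ m) ≡ᵇ toℕ x) e) (≡ᵇ-refl′ (toℕ (i ↑ˡ m)))) of λ ()
      where
      ≡ᵇ-refl′ : ∀ a → (a ≡ᵇ a) ≡ true
      ≡ᵇ-refl′ zero = refl
      ≡ᵇ-refl′ (suc a) = ≡ᵇ-refl′ a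
    f-inj : Inj f
    f-inj {zero}  {zero}  e = refl
    f-inj {zero}  {suc j} e = contradiction e sides
    f-inj {suc i} {zero}  e = contradiction (sym e) sides
    f-inj {suc i} {suc j} e = cong suc (↑ˡ-inj e)
    f-adj : ∀ i → adj (IP t m) (t ↑ʳ a) (f i) ≡ true
    f-adj zero    = [ IP-path {t} a b , (λ e → trans (Graph.sym (IP t m) (t ↑ʳ a) (t ↑ʳ b)) (IP-path {t} b a e)) ]′ near
    f-adj (suc i) = trans (Graph.sym (IP t m) (t ↑ʳ a) (i ↑ˡ m)) (IP-adj {t} i a)
    f∉ : ∀ i → f i ∉ X
    f∉ zero    p = case trans (sym p) b∉X of λ ()
    f∉ (suc i) = left∉ i

theorem7 : (𝒢 : Class) → MinorClosed 𝒢 → BoundedTreewidth 𝒢 →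
    (t : ℕ) → 1 ≤ t →
    ColStarLe 𝒢 t ⇔ (∃[ m ] (1 ≤ m × ¬ 𝒢 (K t m) × ¬ 𝒢 (IP (t ∸ 1) m)))
theorem7 𝒢 (_ , minorClosed) (w , tw) (suc t) _ = mk⇔ forward backward
  where
  forward : ColStarLe 𝒢 (suc t) → ∃[ m ] (1 ≤ m × ¬ 𝒢 (K (suc t) m) × ¬ 𝒢 (IP t m))
  forward (t₁ , t₁≤ , C , _ , islands) = suc t + C , s≤s z≤n ,
    (λ g → let t₂ , t₂≤ , isl = islands _ g in K-no-islands (ℕ.≤-trans t₂≤ t₁≤) isl) ,
    (λ g → let t₂ , t₂≤ , isl = islands _ g in IP-no-islands (ℕ.≤-trans t₂≤ t₁≤) isl)
  backward : ∃[ m ] (1 ≤ m × ¬ 𝒢 (K (suc t) m) × ¬ 𝒢 (IP t m)) → ColStarLe 𝒢 (suc t)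
  backward (m , 1≤m , noK , noIP) = suc t , ℕ.≤-refl , islandSize m (suc w) , s≤s z≤n , λ G g →
    suc t , ℕ.≤-refl , excluded⇒islands t 1≤m (tw G g) (noK ∘ minorClosed G _ g) (noIP ∘ minorClosed G _ g)
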